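{- Let $\Sigma$ be a finite set and $k\ge 0$, and let $\Phi_1,\Phi_2$ be patterns for the class $\mathsf E_k\Sigma$. If $\Phi_1$ and $\Phi_2$ are not isomorphic, then the functions they define are not equivalent, i.e.\ there is an input tree $t\in\mathsf E_k\Sigma$ such that the output trees $\Phi_1(t)$ and $\Phi_2(t)$ are not isomorphic.
   Context: $\mathsf E_k\Sigma$ is the class of finite unordered trees of height at most $k$ with edges labelled by $\Sigma$, in the edge representation: universe = edges, unary relations for labels, and a parent function mapping each edge to its parent edge (looping on edges from the root). Induced substructures are subsets of edges closed under the parent function (pruned trees; the empty structure represents the root-only tree); an embedding is an injective map on edges preserving labels and the parent function. A pattern for $\mathsf E_k\Sigma$ is a finite rooted tree $\Phi$ with each node $x$ labelled by $\Phi(x)\in\mathsf E_k\Sigma$, the root labelled by the empty structure, and $\Phi(x)$ an induced substructure of $\Phi(y)$ whenever $x$ is the parent of $y$. The function defined by $\Phi$ maps $t$ to the unlabelled tree whose nodes are pairs $(x,\alpha)$ with $\alpha:\Phi(x)\hookrightarrow t$ an embedding, with children of $(x,\alpha)$ being the $(y,\beta)$ such that $y$ is a child of $x$ and $\beta$ extends $\alpha$. Two patterns are isomorphic if there is a bijection between their underlying trees preserving the tree structure, together with a family of isomorphisms, one for each node $x$ of the first pattern, from its label to the label of the corresponding node of the second pattern, such that the isomorphism for a node extends the isomorphism for its parent. -}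

module Defs where

open import Data.Nat using (ℕ; zero; suc; _<_)
open import Data.Fin using (Fin; _≟_)
open import Data.Fin.Properties using (all?)
open import Data.Vec using (Vec; []; lookup; map)
open import Data.Product using (Σ; Σ-syntax; ∃-syntax; _×_; _,_)
open import Data.Product.Properties using ()
open import Relation.Nullary using (Dec; yes; no; ¬_)
open import Relation.Nullary.Decidable using (True; _×-dec_; _→-dec_)
open import Relation.Binary.PropositionalEquality using (_≡_)
open import Function.Bundles using (_↔_; Inverse)

iter : ∀ {A : Set} → (A → A) → ℕ → A → A
iter f zero    x = x
iter f (suc i) x = f (iter f i x)

-- E_k Σ : finite trees of height ≤ k with edges labelled by Fin s, in
-- the edge representation.  Universe = edges = Fin size; every edge has
-- one label; parent maps an edge to its parent edge, looping on the
-- edges leaving the root.  Height ≤ k: from every edge e one reaches an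
-- edge leaving the root (a fixed point of parent) after fewer than k
-- parent steps (so every edge has depth ≤ k; for k = 0 the structure
-- is empty).

record Str (s k : ℕ) : Set where
  field
    size   : ℕ
    label  : Fin size → Fin s
    parent : Fin size → Fin size
    height : ∀ e → ∃[ i ] (i < k × parent (iter parent i e) ≡ iter parent i e)
open Str public

emptyStr : ∀ {s k} → Str s k
emptyStr = record { size = 0 ; label = λ () ; parent = λ () ; height = λ () }

IsEmb : ∀ {s k} (A B : Str s k) → Vec (Fin (size B)) (size A) → Set
IsEmb A B v =
    (∀ i j → lookup v i ≡ lookup v j → i ≡ j)
  × (∀ e → label B (lookup v e) ≡ label A e)
  × (∀ e → parent B (lookup v e) ≡ lookup v (parent A e))

isEmb? : ∀ {s k} (A B : Str s k) (v : Vec (Fin (size B)) (size A)) → Dec (IsEmb A B v)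
isEmb? A B v =
      all? (λ i → all? (λ j → (lookup v i ≟ lookup v j) →-dec (i ≟ j)))
  ×-dec all? (λ e → label B (lookup v e) ≟ label A e)
  ×-dec all? (λ e → parent B (lookup v e) ≟ lookup v (parent A e))

-- An embedding: its map together with a (proof-irrelevant) certificate
-- that the map is an embedding, so that embeddings are determined by
-- their maps.
record Emb {s k} (A B : Str s k) : Set where
  constructor _,_
  field
    emb   : Vec (Fin (size B)) (size A)
    isEmb : True (isEmb? A B emb)
open Emb public

Extends : ∀ {s k} {A B T : Str s k} → Emb A B → Emb B T → Emb A T → Set
Extends ι β α = map (lookup (emb β)) (emb ι) ≡ emb α

emptyEmb : ∀ {s k} (t : Str s k) → Emb emptyStr t
emptyEmb t = [] , _

record Iso {s k} (A B : Str s k) : Set where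
  field
    bij       : Fin (size A) ↔ Fin (size B)
  open Inverse bij public using (to)
  field
    to-label  : ∀ e → label B (to e) ≡ label A e
    to-parent : ∀ e → parent B (to e) ≡ to (parent A e)
open Iso public using (to)

-- Patterns.  PTree A is a finite rooted tree whose root is labelled A;
-- a node labelled A has c children, the i-th labelled B i, where
-- A is an induced substructure of B i via the embedding ι i
-- (inclusion of a parent-closed subset of edges).

data PTree {s k} (A : Str s k) : Set where
  node : (c : ℕ) (B : Fin c → Str s k) (ι : (i : Fin c) → Emb A (B i))
         (sub : (i : Fin c) → PTree (B i)) → PTree A

Pattern : ℕ → ℕ → Set
Pattern s k = PTree {s} {k} emptyStr

-- Unordered (finitely branching) rooted trees: the children of a node
-- are indexed by a type; isomorphism = bijection on children with
-- isomorphic subtrees.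

data UTree : Set₁ where
  node : (I : Set) → (I → UTree) → UTree

data _≅ᵘ_ : UTree → UTree → Set₁ where
  node : ∀ {I J f g} (π : I ↔ J) →
         (∀ i → f i ≅ᵘ g (Inverse.to π i)) → node I f ≅ᵘ node J g

eval : ∀ {s k} {A : Str s k} → PTree A → (t : Str s k) → Emb A t → UTree
eval (node c B ι sub) t α =
  node (Σ[ i ∈ Fin c ] Σ[ β ∈ Emb (B i) t ] Extends (ι i) β α)
       (λ { (i , β , _) → eval (sub i) t β })

⟦_⟧ : ∀ {s k} → Pattern s k → Str s k → UTree
⟦ Φ ⟧ t = eval Φ t (emptyEmb t)

data PIso {s k} : {A A' : Str s k} → PTree A → PTree A' → Iso A A' → Set where
  node : ∀ {A A'} {c c'} {B B' ι ι' sub sub'} {τ : Iso A A'}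
         (π : Fin c ↔ Fin c')
         (σ : ∀ i → Iso (B i) (B' (Inverse.to π i)))
         (ext : ∀ i e → to (σ i) (lookup (emb (ι i)) e)
                          ≡ lookup (emb (ι' (Inverse.to π i))) (to τ e))
         (rec : ∀ i → PIso (sub i) (sub' (Inverse.to π i)) (σ i)) →
         PIso {A = A} {A' = A'} (node c B ι sub) (node c' B' ι' sub') τ

_≅ᵖ_ : ∀ {s k} → Pattern s k → Pattern s k → Set
Φ₁ ≅ᵖ Φ₂ = Σ[ τ ∈ Iso emptyStr emptyStr ] PIso Φ₁ Φ₂ τ

{-# OPTIONS --safe #-}
module Submission where

-- Fix S exceeding all sizes and branchings of both patterns, and give every edge of the input tree
-- an index in Fin S. A vertex of index q gets S + Y (q , l , j) children with label l and index j,
-- the Y's being huge and growing at very different rates. Building embeddings edge by edge shows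
-- that the extensions of an embedding with prescribed indices g are counted by a polynomial in the
-- Y's with natural coefficients; if g is injective, its leading monomial is squarefree and records
-- g together with the tree structure of the new edges. Encode an unlabelled tree as the sum of Q ^ u
-- over the codes u of its children. The code of an output tree is then a sum of fewer than R powers
-- of R, whose exponents are packed pairs (monomial, code of a subtree) and can be read off it.
-- To recover a pattern from its code, take a child of maximal size over both patterns and an
-- injective colouring g of it. Its leading monomial must come from a child of the other pattern,
-- which by maximality is isomorphic to it, with the same subtree code; by induction the
-- subpatterns are isomorphic. Equal contributions cancel, and one continues with the rest.

open import Defs
open import Data.Bool.Properties using (T-irrelevant)
open import Data.Empty using (⊥; ⊥-elim; ⊥-elim-irr)
open import Data.Fin using (Fin; zero; suc; toℕ; combine; punchIn; punchOut)
open import Data.Fin.Permutation using (↔⇒≡; insert)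
open import Data.Fin.Properties
  using (all?; any?; injective⇒≤; punchIn-punchOut; toℕ-injective; toℕ<n; combine-injective; +↔⊎; *↔×)
  renaming (_≟_ to _≟F_; suc-injective to Fin-suc-injective)
open import Data.Irrelevant using ([_])
open import Data.List using (List; []; _∷_; _++_; map; concatMap; replicate; length; allFin)
  renaming (tabulate to tabulateL)
open import Data.List.Membership.Propositional using (_∈_; find; lose)
open import Data.List.Membership.Propositional.Properties
  using (∈-map⁺; ∈-map⁻; ∈-allFin; ∈-concatMap⁺; ∈-concatMap⁻)
open import Data.List.Properties
  using (map-++; map-cong; length-++; length-map; length-replicate; length-tabulate)
  renaming (map-∘ to mapL-∘)
open import Data.List.Relation.Binary.Permutation.Propositional
  using (_↭_; ↭-refl; ↭-sym; ↭-trans; prep; ↭-reflexive)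
open import Data.List.Relation.Binary.Permutation.Propositional.Properties
  using (map⁺; ++⁺; shift; ∈-resp-↭)
open import Data.List.Relation.Unary.All as All using (All; []; _∷_)
import Data.List.Relation.Unary.All.Properties as All
open import Data.List.Relation.Unary.Any using (here; there)
open import Data.Nat
open import Data.Nat.DivMod using (_%_; [m+kn]%n≡m%n; m<n⇒m%n≡m)
open import Data.Nat.ListAction using (product) renaming (sum to sumL)
open import Data.Nat.ListAction.Properties using (sum-++)
open import Data.Nat.Properties
open import Data.Nat.Solver using (module +-*-Solver)
open import Data.Product using (Σ; Σ-syntax; ∃-syntax; _×_; _,_; proj₁; proj₂; uncurry)
open import Data.Product.Algebra using (×-cong; Σ-assoc)
import Data.Product.Function.Dependent.Propositional as Σ-Fun
open import Data.Refinement using (Refinement; _,_; value)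
open import Data.Sum using (_⊎_; inj₁; inj₂)
open import Data.Sum.Algebra using (⊎-cong)
open import Data.Sum.Properties using (inj₁-injective)
open import Data.Unit using (⊤; tt)
open import Data.Vec using (Vec; []; _∷_; lookup; tabulate) renaming (map to mapV)
open import Data.Vec.Properties using (lookup-map; lookup∘tabulate; tabulate∘lookup; tabulate-cong; ≡-dec)
open import Algebra.Properties.CommutativeMonoid.Sum +-0-commutativeMonoid
  using (sum; sum-cong-≗; sum-remove; sum-permute)
open import Algebra.Properties.CommutativeSemigroup +-commutativeSemigroup using (x∙yz≈y∙xz)
open import Algebra.Properties.Semiring.Sum +-*-semiring using (*-distribˡ-sum)
open import Axiom.UniquenessOfIdentityProofs.WithK using (uip)
open import Function using (_∘_; id; _↔_; Inverse; mk↔ₛ′; _⇔_; mk⇔; Equivalence)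
open import Function.Construct.Composition using (_↔-∘_)
open import Function.Construct.Identity using (↔-id)
open import Function.Construct.Symmetry using (↔-sym)
open import Relation.Binary.PropositionalEquality hiding (J; [_])
open import Relation.Nullary using (Dec; yes; no; ¬_; contradiction)
open import Relation.Nullary.Decidable using (recompute; _×-dec_; ¬?; toWitness; fromWitness)

-- Counting extensions without indices would see a label only up to isomorphism, whereas an
-- isomorphism of patterns must also extend, at every node, the isomorphism chosen for the parent.
-- An injective colouring names every edge, so what is recovered for a child automatically agrees
-- with what was fixed for its parent. Moreover the branching at a vertex depends on its index
-- alone, so the count of extensions, and with it the code of an output subtree, depends on an
-- embedding only through its colouring. Codes of two patterns can thus be compared without
-- reference to embeddings. The obstacle is the lower-order terms. Edges already hit must be
-- subtracted from the available places, and a lower-order term of a large child may coincide with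
-- the leading term of a small one. The summand S in the branching absorbs the subtraction, which
-- keeps all coefficients natural, and cancelling children from the largest down removes the
-- ambiguity.

private variable
  A B I J X Z : Set

-- Cardinalities of dependent sums and of decidable subsets

bijective⇒↔ : (f : A → B) → (∀ {x y} → f x ≡ f y → x ≡ y) →
              (∀ y → Σ[ x ∈ A ] f x ≡ y) → A ↔ B
bijective⇒↔ f inj surj =
  mk↔ₛ′ f (proj₁ ∘ surj) (proj₂ ∘ surj) (λ x → inj (proj₂ (surj (f x))))

-- The sum of f over the finite type I equals n, expressed by cardinalities.
HasSum : (I → ℕ) → ℕ → Set
HasSum {I} f n = Σ I (Fin ∘ f) ↔ Fin n

hasSum-unique : {f : I → ℕ} {m n : ℕ} → HasSum f m → HasSum f n → m ≡ n
hasSum-unique p q = ↔⇒≡ (q ↔-∘ ↔-sym p)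

hasSum-↔ : {f : I → ℕ} {g : J → ℕ} {n : ℕ} (φ : I ↔ J) →
           (∀ i → f i ≡ g (Inverse.to φ i)) → HasSum g n → HasSum f n
hasSum-↔ φ eq p = p ↔-∘ Σ-Fun.Σ-↔ φ (λ {i} → subst (λ k → Fin _ ↔ Fin k) (eq i) (↔-id _))

hasSum-Fin : ∀ {n} (f : Fin n → ℕ) → HasSum f (sum f)
hasSum-Fin {zero} f = mk↔ₛ′ (λ ()) (λ ()) (λ ()) (λ ())
hasSum-Fin {suc n} f = ↔-sym +↔⊎ ↔-∘ (⊎-cong (↔-id _) (hasSum-Fin (f ∘ suc)) ↔-∘ split)
  where
  split : Σ (Fin (suc n)) (Fin ∘ f) ↔ (Fin (f zero) ⊎ Σ (Fin n) (Fin ∘ f ∘ suc))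
  split = mk↔ₛ′ (λ { (zero , x) → inj₁ x ; (suc i , x) → inj₂ (i , x) })
                (λ { (inj₁ x) → zero , x ; (inj₂ (i , x)) → suc i , x })
                (λ { (inj₁ x) → refl ; (inj₂ _) → refl })
                (λ { (zero , x) → refl ; (suc i , x) → refl })

hasSum-Σ : {K : J → Set} {f : (j : J) → K j → ℕ} {m : J → ℕ} {n : ℕ} →
           (∀ j → HasSum (f j) (m j)) → HasSum m n → HasSum (uncurry f) n
hasSum-Σ p q = (q ↔-∘ Σ-Fun.congˡ (λ {j} → p j)) ↔-∘ Σ-assoc

hasSum-const : ∀ {n} (c : ℕ) → I ↔ Fin n → HasSum {I} (λ _ → c) (n * c)
hasSum-const c φ = ↔-sym *↔× ↔-∘ ×-cong φ (↔-id _)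

finite-Σ : {K : I → Set} → (∃[ n ] I ↔ Fin n) → (∀ i → ∃[ n ] K i ↔ Fin n) →
           ∃[ n ] Σ I K ↔ Fin n
finite-Σ {I} (n , φ) ψ = _ , hasSum-↔ {g = k ∘ Inverse.from φ} φ
    (λ i → cong k (sym (Inverse.strictlyInverseʳ φ i))) (hasSum-Fin _)
    ↔-∘ Σ-Fun.congˡ (λ {i} → proj₂ (ψ i))
  where
  k : I → ℕ
  k i = proj₁ (ψ i)

-- Subsets are written as `Refinement`, whose proof component is irrelevant: elements are equal as
-- soon as their values are, so that cardinalities count points and not proofs.
refinement-≡ : {P : A → Set} {v w : Refinement A P} → value v ≡ value w → v ≡ w
refinement-≡ refl = refl

refinement-⇔ : {P Q : A → Set} → (∀ x → P x ⇔ Q x) → Refinement A P ↔ Refinement A Q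
refinement-⇔ eq = mk↔ₛ′
  (λ (x , [ p ]) → x , [ Equivalence.to (eq x) p ])
  (λ (x , [ q ]) → x , [ Equivalence.from (eq x) q ])
  (λ _ → refl) (λ _ → refl)

indicator : Dec A → ℕ
indicator (yes _) = 1
indicator (no _) = 0

count : ∀ {n} {P : Fin n → Set} → (∀ i → Dec (P i)) → ℕ
count P? = sum (λ i → indicator (P? i))

refinement-finite : ∀ {n} {P : Fin n → Set} (P? : ∀ i → Dec (P i)) →
                    Refinement (Fin n) P ↔ Fin (count P?)
refinement-finite {n} {P} P? = hasSum-Fin _ ↔-∘ bijective⇒↔ f inj surj
  where
  pick : ∀ {X : Set} (d : Dec X) → .X → Fin (indicator d)
  pick (yes _) _ = zero
  pick (no ¬x) x = ⊥-elim-irr (¬x x)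
  pick-all : ∀ {X : Set} (d : Dec X) (y : Fin (indicator d)) → Σ[ x ∈ X ] pick d x ≡ y
  pick-all (yes x) zero = x , refl
  f : Refinement (Fin n) P → Σ (Fin n) (Fin ∘ indicator ∘ P?)
  f (i , [ p ]) = i , pick (P? i) p
  inj : ∀ {x y} → f x ≡ f y → x ≡ y
  inj eq = refinement-≡ (cong proj₁ eq)
  surj : ∀ y → Σ[ x ∈ Refinement (Fin n) P ] f x ≡ y
  surj (i , y) with pick-all (P? i) y
  ... | p , eq = (i , [ p ]) , cong (i ,_) eq

indicator-⇔ : (a : Dec A) (b : Dec B) → A ⇔ B → indicator a ≡ indicator b
indicator-⇔ (yes _) (yes _) _ = refl
indicator-⇔ (yes a) (no ¬b) e = contradiction (Equivalence.to e a) ¬b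
indicator-⇔ (no ¬a) (yes b) e = contradiction (Equivalence.from e b) ¬a
indicator-⇔ (no _) (no _) _ = refl

count-⇔ : ∀ {n} {P Q : Fin n → Set} (P? : ∀ i → Dec (P i)) (Q? : ∀ i → Dec (Q i)) →
          (∀ i → P i ⇔ Q i) → count P? ≡ count Q?
count-⇔ P? Q? eq = sum-cong-≗ (λ i → indicator-⇔ (P? i) (Q? i) (eq i))

count≤ : ∀ {n} {P : Fin n → Set} (P? : ∀ i → Dec (P i)) → count P? ≤ n
count≤ {zero} P? = z≤n
count≤ {suc n} P? = +-mono-≤ (ind≤1 (P? zero)) (count≤ (P? ∘ suc))
  where
  ind≤1 : ∀ {X : Set} (d : Dec X) → indicator d ≤ 1
  ind≤1 (yes _) = ≤-refl
  ind≤1 (no _) = z≤n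

-- The points of P hit by an injection δ and the points missed by it partition P.
count-missed : ∀ {n m N} {P : Fin n → Set} (P? : ∀ x → Dec (P x)) (δ : Fin m → Fin n) →
               (∀ {i j} → δ i ≡ δ j → i ≡ j) → Refinement (Fin n) P ↔ Fin N →
               Refinement (Fin n) (λ x → P x × (∀ i → δ i ≢ x)) ↔ Fin (N ∸ count (P? ∘ δ))
count-missed {n} {m} {N} {P} P? δ δ-inj φ =
    subst (λ z → Refinement (Fin n) Missed ↔ Fin z)
          (sym (trans (cong (_∸ count (P? ∘ δ)) total) (m+n∸n≡m _ (count (P? ∘ δ)))))
          (refinement-finite missed?)
  where
  Missed : Fin n → Set
  Missed x = P x × (∀ i → δ i ≢ x)
  missed? : ∀ x → Dec (Missed x)
  missed? x = P? x ×-dec all? (λ i → ¬? (δ i ≟F x))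
  f : Refinement (Fin n) Missed ⊎ Refinement (Fin m) (P ∘ δ) → Refinement (Fin n) P
  f (inj₁ (x , [ p ])) = x , [ proj₁ p ]
  f (inj₂ (i , [ p ])) = δ i , [ p ]
  inj : ∀ {u v} → f u ≡ f v → u ≡ v
  inj {inj₁ _} {inj₁ _} eq = cong inj₁ (refinement-≡ (cong value eq))
  inj {inj₁ (x , [ p ])} {inj₂ (i , _)} eq =
    ⊥-elim (proj₂ (recompute (missed? x) p) i (sym (cong value eq)))
  inj {inj₂ (i , _)} {inj₁ (x , [ p ])} eq =
    ⊥-elim (proj₂ (recompute (missed? x) p) i (cong value eq))
  inj {inj₂ _} {inj₂ _} eq = cong inj₂ (refinement-≡ (δ-inj (cong value eq)))
  surj : ∀ y → ∃[ x ] f x ≡ y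
  surj (x , [ p ]) with any? (λ i → δ i ≟F x)
  ... | yes (i , refl) = inj₂ (i , [ p ]) , refl
  ... | no ¬hit = inj₁ (x , [ (p , λ i eq → ¬hit (i , eq)) ]) , refl
  total : N ≡ count missed? + count (P? ∘ δ)
  total = ↔⇒≡ (↔-sym +↔⊎ ↔-∘ (⊎-cong (refinement-finite missed?) (refinement-finite (P? ∘ δ))
              ↔-∘ (↔-sym (bijective⇒↔ f (λ {u v} → inj {u} {v}) surj) ↔-∘ ↔-sym φ)))

-- Base b expansions given by lists of exponents

powerSum : ℕ → List ℕ → ℕ
powerSum b = sumL ∘ map (b ^_)

zeros : List ℕ → ℕ
zeros [] = 0
zeros (zero ∷ xs) = suc (zeros xs)
zeros (suc _ ∷ xs) = zeros xs

preds : List ℕ → List ℕ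
preds [] = []
preds (zero ∷ xs) = preds xs
preds (suc x ∷ xs) = x ∷ preds xs

zeros-preds-↭ : ∀ xs → xs ↭ replicate (zeros xs) 0 ++ map suc (preds xs)
zeros-preds-↭ [] = ↭-refl
zeros-preds-↭ (zero ∷ xs) = prep 0 (zeros-preds-↭ xs)
zeros-preds-↭ (suc x ∷ xs) =
  ↭-trans (prep (suc x) (zeros-preds-↭ xs)) (↭-sym (shift (suc x) (replicate (zeros xs) 0) _))

zeros≤length : ∀ xs → zeros xs ≤ length xs
zeros≤length [] = z≤n
zeros≤length (zero ∷ xs) = s≤s (zeros≤length xs)
zeros≤length (suc _ ∷ xs) = m≤n⇒m≤1+n (zeros≤length xs)

length-preds≤ : ∀ xs → length (preds xs) ≤ length xs
length-preds≤ [] = z≤n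
length-preds≤ (zero ∷ xs) = m≤n⇒m≤1+n (length-preds≤ xs)
length-preds≤ (suc _ ∷ xs) = s≤s (length-preds≤ xs)

preds-< : ∀ {n} xs → All (_< suc n) xs → All (_< n) (preds xs)
preds-< [] [] = []
preds-< (zero ∷ xs) (_ ∷ h) = preds-< xs h
preds-< (suc x ∷ xs) (s≤s x<n ∷ h) = x<n ∷ preds-< xs h

-- The list is a numeral in base `b` whose digit at place i is the multiplicity of i. The zeros form
-- the last digit, and `preds` shifts the other digits down by one place.
powerSum-split : ∀ b xs → powerSum b xs ≡ zeros xs + powerSum b (preds xs) * b
powerSum-split b [] = refl
powerSum-split b (zero ∷ xs) = cong suc (powerSum-split b xs)
powerSum-split b (suc x ∷ xs) = begin
  b * b ^ x + powerSum b xs                            ≡⟨ cong₂ _+_ (*-comm b (b ^ x)) (powerSum-split b xs) ⟩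
  b ^ x * b + (zeros xs + powerSum b (preds xs) * b)   ≡⟨ x∙yz≈y∙xz (b ^ x * b) (zeros xs) _ ⟩
  zeros xs + (b ^ x * b + powerSum b (preds xs) * b)   ≡⟨ cong (zeros xs +_) (*-distribʳ-+ b (b ^ x) _) ⟨
  zeros xs + (b ^ x + powerSum b (preds xs)) * b       ∎
  where
  open ≡-Reasoning

-- Used twice: to split off the last digit of a numeral, and, with `W` for `b`, to unpack a pair of
-- a monomial code and a subtree code.
divMod-unique : ∀ {b x y} q r → x < b → y < b → x + q * b ≡ y + r * b → x ≡ y × q ≡ r
divMod-unique {b} {x} {y} q r x<b y<b eq =
  x≡y , *-cancelʳ-≡ q r b (+-cancelˡ-≡ y _ _ (trans (cong (_+ q * b) (sym x≡y)) eq))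
  where
  instance
    b≢0 : NonZero b
    b≢0 = >-nonZero (≤-<-trans z≤n x<b)
  x≡y : x ≡ y
  x≡y = begin
    x                ≡⟨ m<n⇒m%n≡m x<b ⟨
    x % b            ≡⟨ [m+kn]%n≡m%n x q b ⟨
    (x + q * b) % b  ≡⟨ cong (_% b) eq ⟩
    (y + r * b) % b  ≡⟨ [m+kn]%n≡m%n y r b ⟩
    y % b            ≡⟨ m<n⇒m%n≡m y<b ⟩
    y                ∎
    where open ≡-Reasoning

∈⇒≤sum : ∀ {x xs} → x ∈ xs → x ≤ sumL xs
∈⇒≤sum (here refl) = m≤m+n _ _
∈⇒≤sum (there {x = y} x∈xs) = m≤n⇒m≤o+n y (∈⇒≤sum x∈xs)

-- A list with fewer than `b` entries has all multiplicities below `b`, so no carry occurs and the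
-- digits are determined. The recursion runs on a bound for the exponents, because passing to
-- `preds` lowers every exponent but need not shorten the list.
powerSum-injective : ∀ {b} xs ys → length xs < b → length ys < b →
                     powerSum b xs ≡ powerSum b ys → xs ↭ ys
powerSum-injective {b} xs ys xs<b ys<b =
  go (suc (sumL xs ⊔ sumL ys)) xs ys
     (All.tabulate λ x∈xs → s≤s (≤-trans (∈⇒≤sum x∈xs) (m≤m⊔n _ _)))
     (All.tabulate λ y∈ys → s≤s (≤-trans (∈⇒≤sum y∈ys) (m≤n⊔m (sumL xs) _))) xs<b ys<b
  where
  go : ∀ n xs ys → All (_< n) xs → All (_< n) ys → length xs < b → length ys < b →
       powerSum b xs ≡ powerSum b ys → xs ↭ ys
  go zero [] [] _ _ _ _ _ = ↭-refl
  go zero _ (_ ∷ _) _ (() ∷ _)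
  go zero (_ ∷ _) _ (() ∷ _)
  go (suc n) xs ys hx hy xs<b ys<b eq
    with divMod-unique (powerSum b (preds xs)) (powerSum b (preds ys))
           (≤-<-trans (zeros≤length xs) xs<b) (≤-<-trans (zeros≤length ys) ys<b)
           (trans (sym (powerSum-split b xs)) (trans eq (powerSum-split b ys)))
  ... | z≡z , p≡p =
    ↭-trans (zeros-preds-↭ xs)
      (↭-trans (++⁺ (↭-reflexive (cong (λ z → replicate z 0) z≡z))
                    (map⁺ suc (go n (preds xs) (preds ys) (preds-< xs hx) (preds-< ys hy)
                       (≤-<-trans (length-preds≤ xs) xs<b) (≤-<-trans (length-preds≤ ys) ys<b) p≡p)))
               (↭-sym (zeros-preds-↭ ys)))

-- The input tree and its branching

iter-shift : ∀ {A : Set} (f : A → A) i x → iter f i (f x) ≡ f (iter f i x)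
iter-shift f zero x = refl
iter-shift f (suc i) x = cong f (iter-shift f i x)

-- Edges of t are identified with their lower endpoints; Vertex d consists of the vertices at depth d.
module Tree (s S : ℕ) (branching : Fin (suc S) → Fin s → Fin S → ℕ) where

  Spot : Fin (suc S) → Set
  Spot q = Σ[ l ∈ Fin s ] Σ[ j ∈ Fin S ] Fin (branching q l j)

  -- Defined together with `vertexIx` by recursion on the depth, since the children of a vertex
  -- depend on its index. The index is that of the edge above the vertex, shifted by one so that
  -- zero remains for the root.
  Vertex : ℕ → Set
  vertexIx : ∀ d → Vertex d → Fin (suc S)

  Vertex zero = ⊤
  Vertex (suc d) = Σ[ v ∈ Vertex d ] Spot (vertexIx d v)

  vertexIx zero _ = zero
  vertexIx (suc d) (_ , _ , j , _) = suc j

  Edge : ℕ → Set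
  Edge zero = ⊥
  Edge (suc k) = Edge k ⊎ Vertex (suc k)

  up : ∀ k → Edge k → Edge k
  up (suc k) (inj₁ e) = inj₁ (up k e)
  up (suc zero) (inj₂ v) = inj₂ v
  up (suc (suc k)) (inj₂ (v , _)) = inj₁ (inj₂ v)

  edgeLabel : ∀ k → Edge k → Fin s
  edgeLabel (suc k) (inj₁ e) = edgeLabel k e
  edgeLabel (suc k) (inj₂ (_ , l , _)) = l

  edgeIx : ∀ k → Edge k → Fin S
  edgeIx (suc k) (inj₁ e) = edgeIx k e
  edgeIx (suc k) (inj₂ (_ , _ , j , _)) = j

  -- The edges strictly above are counted, so an edge leaving the root has depth 0 and the lowest
  -- level of `Edge (suc k)` has depth `k`.
  depth : ∀ k → Edge k → ℕ
  depth (suc k) (inj₁ e) = depth k e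
  depth (suc k) (inj₂ _) = k

  abstract
    vertex-finite : ∀ d → ∃[ n ] Vertex d ↔ Fin n
    vertex-finite zero = 1 , mk↔ₛ′ (λ _ → zero) (λ _ → tt) (λ { zero → refl }) (λ _ → refl)
    vertex-finite (suc d) = finite-Σ (vertex-finite d) λ v →
      finite-Σ (s , ↔-id _) λ l → finite-Σ (S , ↔-id _) λ j → _ , ↔-id _

    edge-finite : ∀ k → ∃[ n ] Edge k ↔ Fin n
    edge-finite zero = 0 , mk↔ₛ′ (λ ()) (λ ()) (λ ()) (λ ())
    edge-finite (suc k) with edge-finite k | vertex-finite (suc k)
    ... | m , φ | n , ψ = m + n , ↔-sym +↔⊎ ↔-∘ ⊎-cong φ ψ

  iter-inj₁ : ∀ k i e → iter (up (suc k)) i (inj₁ e) ≡ inj₁ (iter (up k) i e)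
  iter-inj₁ k zero e = refl
  iter-inj₁ k (suc i) e = cong (up (suc k)) (iter-inj₁ k i e)

  up-height : ∀ k (e : Edge k) → ∃[ i ] (i < k × up k (iter (up k) i e) ≡ iter (up k) i e)
  up-height (suc k) (inj₁ e) with up-height k e
  ... | i , i<k , eq = i , m<n⇒m<1+n i<k ,
    trans (cong (up (suc k)) (iter-inj₁ k i e)) (trans (cong inj₁ eq) (sym (iter-inj₁ k i e)))
  up-height (suc zero) (inj₂ v) = 0 , z<s , refl
  up-height (suc (suc k)) (inj₂ v@(w , _)) with up-height (suc k) (inj₂ w)
  ... | i , i<k , eq = suc i , s<s i<k , trans (cong f step) (trans fixed (sym step))
    where
    f = up (suc (suc k))
    step : f (iter f i (inj₂ v)) ≡ inj₁ (iter (up (suc k)) i (inj₂ w))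
    step = trans (sym (iter-shift f i (inj₂ v))) (iter-inj₁ (suc k) i (inj₂ w))
    fixed : f (inj₁ (iter (up (suc k)) i (inj₂ w))) ≡ inj₁ (iter (up (suc k)) i (inj₂ w))
    fixed = cong inj₁ eq

  depth-root : ∀ k e → up k e ≡ e → depth k e ≡ 0
  depth-root (suc k) (inj₁ e) eq = depth-root k e (inj₁-injective eq)
  depth-root (suc zero) (inj₂ v) eq = refl
  depth-root (suc (suc k)) (inj₂ v) ()

  depth-up : ∀ k e → depth k e ≤ suc (depth k (up k e))
  depth-up (suc k) (inj₁ e) = depth-up k e
  depth-up (suc zero) (inj₂ v) = z≤n
  depth-up (suc (suc k)) (inj₂ v) = ≤-refl

  depth-iter : ∀ k i e → depth k e ≤ i + depth k (iter (up k) i e)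
  depth-iter k zero e = ≤-refl
  depth-iter k (suc i) e = begin
    depth k e                                   ≤⟨ depth-iter k i e ⟩
    i + depth k (iter (up k) i e)               ≤⟨ +-monoʳ-≤ i (depth-up k _) ⟩
    i + suc (depth k (up k (iter (up k) i e)))  ≡⟨ +-suc i _ ⟩
    suc i + depth k (up k (iter (up k) i e))    ∎
    where open ≤-Reasoning

  depth-bound : ∀ k i e → up k (iter (up k) i e) ≡ iter (up k) i e → depth k e ≤ i
  depth-bound k i e eq = subst (depth k e ≤_)
    (trans (cong (i +_) (depth-root k _ eq)) (+-identityʳ i)) (depth-iter k i e)

  rootEdge : ∀ k → Spot zero → Edge (suc k)
  rootEdge zero y = inj₂ (tt , y)
  rootEdge (suc k) y = inj₁ (rootEdge k y)

  -- In the tree of height `suc k`, the edges coming from `Edge k` are exactly those not on the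
  -- lowest level, hence those below which the tree has not been cut off.
  childEdge : ∀ k (e : Edge k) → Spot (suc (edgeIx k e)) → Edge (suc k)
  childEdge (suc k) (inj₁ e) y = inj₁ (childEdge k e y)
  childEdge (suc k) (inj₂ v) y = inj₂ (v , y)

  data View (k : ℕ) : Edge (suc k) → Set where
    root  : ∀ y → View k (rootEdge k y)
    child : ∀ e y → View k (childEdge k e y)

  view : ∀ k x → View k x
  view zero (inj₂ (tt , y)) = root y
  view (suc k) (inj₁ x) with view k x
  ... | root y = root y
  ... | child e y = child (inj₁ e) y
  view (suc k) (inj₂ (v , y)) = child (inj₂ v) y

  up-root : ∀ k y → up (suc k) (rootEdge k y) ≡ rootEdge k y
  up-root zero y = refl
  up-root (suc k) y = cong inj₁ (up-root k y)

  up-child : ∀ k e y → up (suc k) (childEdge k e y) ≡ inj₁ e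
  up-child (suc k) (inj₁ e) y = cong inj₁ (up-child k e y)
  up-child (suc k) (inj₂ v) y = refl

  child≢ : ∀ k e y → childEdge k e y ≢ inj₁ e
  child≢ (suc k) (inj₁ e) y eq = child≢ k e y (inj₁-injective eq)

  label-root : ∀ k y → edgeLabel (suc k) (rootEdge k y) ≡ proj₁ y
  label-root zero y = refl
  label-root (suc k) y = label-root k y

  label-child : ∀ k e y → edgeLabel (suc k) (childEdge k e y) ≡ proj₁ y
  label-child (suc k) (inj₁ e) y = label-child k e y
  label-child (suc k) (inj₂ v) y = refl

  ix-root : ∀ k y → edgeIx (suc k) (rootEdge k y) ≡ proj₁ (proj₂ y)
  ix-root zero y = refl
  ix-root (suc k) y = ix-root k y

  ix-child : ∀ k e y → edgeIx (suc k) (childEdge k e y) ≡ proj₁ (proj₂ y)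
  ix-child (suc k) (inj₁ e) y = ix-child k e y
  ix-child (suc k) (inj₂ v) y = refl

  root-injective : ∀ k {y z} → rootEdge k y ≡ rootEdge k z → y ≡ z
  root-injective zero refl = refl
  root-injective (suc k) eq = root-injective k (inj₁-injective eq)

  child-injective : ∀ k e {y z} → childEdge k e y ≡ childEdge k e z → y ≡ z
  child-injective (suc k) (inj₁ e) eq = child-injective k e (inj₁-injective eq)
  child-injective (suc k) (inj₂ v) refl = refl

  spotFin : ∀ {q l j} → Fin (branching q l j) → Spot q
  spotFin {l = l} {j} i = l , j , i

  tree : ∀ k → Str s k
  tree k = record
    { size = proj₁ (edge-finite k)
    ; label = edgeLabel k ∘ unenum
    ; parent = enum ∘ up k ∘ unenum
    ; height = h }
    where
    open Inverse (proj₂ (edge-finite k))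
      using (strictlyInverseʳ; strictlyInverseˡ) renaming (to to enum; from to unenum)
    iter-enum : ∀ i x → iter (enum ∘ up k ∘ unenum) i x ≡ enum (iter (up k) i (unenum x))
    iter-enum zero x = sym (strictlyInverseˡ x)
    iter-enum (suc i) x = cong (enum ∘ up k) (trans (cong unenum (iter-enum i x)) (strictlyInverseʳ _))
    h : ∀ x → ∃[ i ] (i < k × iter (enum ∘ up k ∘ unenum) (suc i) x ≡ iter (enum ∘ up k ∘ unenum) i x)
    h x with up-height k (unenum x)
    ... | i , i<k , eq = i , i<k , trans (iter-enum (suc i) x) (trans (cong enum eq) (sym (iter-enum i x)))

  module _ {k : ℕ} where
    open Inverse (proj₂ (edge-finite k))
      using (strictlyInverseʳ; strictlyInverseˡ) renaming (to to enum; from to unenum)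

    ix : Fin (size (tree k)) → Fin S
    ix = edgeIx k ∘ unenum

    enum-injective : ∀ {x y} → enum x ≡ enum y → x ≡ y
    enum-injective {x} {y} eq = trans (sym (strictlyInverseʳ x)) (trans (cong unenum eq) (strictlyInverseʳ y))

    tree-iter : ∀ i x → iter (parent (tree k)) i x ≡ enum (iter (up k) i (unenum x))
    tree-iter zero x = sym (strictlyInverseˡ x)
    tree-iter (suc i) x = cong (enum ∘ up k) (trans (cong unenum (tree-iter i x)) (strictlyInverseʳ _))

  RootSpot : ∀ k → Fin s → Fin S → Fin (size (tree k)) → Set
  RootSpot k l j x = parent (tree k) x ≡ x × label (tree k) x ≡ l × ix x ≡ j

  -- An edge leaving the root is its own parent without being its own child; `x ≢ e` excludes it.
  -- The condition `i ≢ p` in `SamePlace` has the same origin.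
  ChildSpot : ∀ k → Fin (size (tree k)) → Fin s → Fin S → Fin (size (tree k)) → Set
  ChildSpot k e l j x = (parent (tree k) x ≡ e × x ≢ e) × label (tree k) x ≡ l × ix x ≡ j

  rootSpot? : ∀ k l j x → Dec (RootSpot k l j x)
  rootSpot? k l j x = (_ ≟F _) ×-dec (_ ≟F _) ×-dec (_ ≟F _)

  childSpot? : ∀ k e l j x → Dec (ChildSpot k e l j x)
  childSpot? k e l j x = ((_ ≟F _) ×-dec ¬? (_ ≟F _)) ×-dec (_ ≟F _) ×-dec (_ ≟F _)

  rootSpot-count : ∀ {k} → 0 < k → ∀ l j →
                   Refinement (Fin (size (tree k))) (RootSpot _ l j) ↔ Fin (branching zero l j)
  rootSpot-count {suc k} _ l j = ↔-sym (bijective⇒↔ f inj surj)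
    where
    open Inverse (proj₂ (edge-finite (suc k)))
      using (strictlyInverseʳ; strictlyInverseˡ) renaming (to to enum; from to unenum)
    g : Fin (branching zero l j) → Edge (suc k)
    g = rootEdge k ∘ spotFin
    f : Fin (branching zero l j) → Refinement (Fin (size (tree (suc k)))) (RootSpot _ l j)
    f i = enum (g i) , [ cong enum (trans (cong (up (suc k)) (strictlyInverseʳ _)) (up-root k _))
                     , trans (cong (edgeLabel (suc k)) (strictlyInverseʳ (g i))) (label-root k _)
                     , trans (cong (edgeIx (suc k)) (strictlyInverseʳ (g i))) (ix-root k _) ]
    inj : ∀ {x y} → f x ≡ f y → x ≡ y
    inj eq with root-injective k (enum-injective (cong value eq))
    ... | refl = refl
    hit : ∀ z → View k z → up (suc k) z ≡ z → edgeLabel (suc k) z ≡ l → edgeIx (suc k) z ≡ j →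
          ∃[ i ] g i ≡ z
    hit _ (root (l′ , j′ , i)) _ ll jj
      with trans (sym (label-root k (l′ , j′ , i))) ll | trans (sym (ix-root k (l′ , j′ , i))) jj
    ... | refl | refl = i , refl
    hit _ (child e y) u _ _ = contradiction (trans (sym u) (up-child k e y)) (child≢ k e y)
    surj : ∀ y → ∃[ i ] f i ≡ y
    surj (x , [ p ]) with recompute (rootSpot? _ l j x) p
    ... | u , ll , jj with hit (unenum x) (view k (unenum x))
                             (trans (sym (strictlyInverseʳ _)) (cong unenum u)) ll jj
    ... | i , eq = i , refinement-≡ (trans (cong enum eq) (strictlyInverseˡ x))

  -- On the lowest level an edge has no children, whatever its index. Reaching an edge that leaves
  -- the root within `i` steps bounds the depth of `e` by `i`, and `suc i < k` then keeps `e` off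
  -- that level.
  childSpot-count : ∀ {k} e i → suc i < k → iter (parent (tree k)) (suc i) e ≡ iter (parent (tree k)) i e →
                    ∀ l j → Refinement (Fin (size (tree k))) (ChildSpot _ e l j) ↔ Fin (branching (suc (ix e)) l j)
  childSpot-count {suc k} e i (s≤s i<k) fixed l j with Inverse.from (proj₂ (edge-finite (suc k))) e in eq
  ... | inj₂ v = ⊥-elim (<⇒≱ i<k (depth-bound (suc k) i (inj₂ v)
                   (subst (λ z → iter (up (suc k)) (suc i) z ≡ iter (up (suc k)) i z) eq
                     (enum-injective (trans (sym (tree-iter (suc i) e)) (trans fixed (tree-iter i e)))))))
  ... | inj₁ e′ = ↔-sym (bijective⇒↔ f inj surj)
    where
    open Inverse (proj₂ (edge-finite (suc k)))
      using (strictlyInverseʳ; strictlyInverseˡ) renaming (to to enum; from to unenum)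
    e≡ : enum (inj₁ e′) ≡ e
    e≡ = trans (cong enum (sym eq)) (strictlyInverseˡ e)
    g : Fin (branching (suc (edgeIx k e′)) l j) → Edge (suc k)
    g = childEdge k e′ ∘ spotFin
    f : Fin (branching (suc (edgeIx k e′)) l j) → Refinement (Fin (size (tree (suc k)))) (ChildSpot _ e l j)
    f i = enum (g i) , [ ( trans (cong enum (trans (cong (up (suc k)) (strictlyInverseʳ _)) (up-child k e′ _))) e≡
                       , λ w → child≢ k e′ _ (enum-injective (trans w (sym e≡))))
                     , trans (cong (edgeLabel (suc k)) (strictlyInverseʳ (g i))) (label-child k e′ _)
                     , trans (cong (edgeIx (suc k)) (strictlyInverseʳ (g i))) (ix-child k e′ _) ]
    inj : ∀ {x y} → f x ≡ f y → x ≡ y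
    inj eq with child-injective k e′ (enum-injective (cong value eq))
    ... | refl = refl
    hit : ∀ z → View k z → up (suc k) z ≡ inj₁ e′ → z ≢ inj₁ e′ →
          edgeLabel (suc k) z ≡ l → edgeIx (suc k) z ≡ j → ∃[ i ] g i ≡ z
    hit _ (child e″ y) u _ ll jj with inj₁-injective (trans (sym (up-child k e″ y)) u)
    hit _ (child e″ (l′ , j′ , i)) u _ ll jj | refl
      with trans (sym (label-child k e″ (l′ , j′ , i))) ll | trans (sym (ix-child k e″ (l′ , j′ , i))) jj
    ... | refl | refl = i , refl
    hit _ (root y) u z≢ _ _ = contradiction (trans (sym (up-root k y)) u) z≢
    surj : ∀ y → ∃[ i ] f i ≡ y
    surj (x , [ p ]) with recompute (childSpot? _ e l j x) p
    ... | (u , x≢e) , ll , jj with hit (unenum x) (view k (unenum x))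
            (trans (sym (strictlyInverseʳ _)) (trans (cong unenum u) eq))
            (λ w → x≢e (trans (sym (strictlyInverseˡ x)) (trans (cong enum w) e≡))) ll jj
    ... | i , eq′ = i , refinement-≡ (trans (cong enum eq′) (strictlyInverseˡ x))

-- Enumerations of new edges and the formal terms they generate

sum-concatMap : (f : X → ℕ) (g : Z → List X) (zs : List Z) →
                sumL (map f (concatMap g zs)) ≡ sumL (map (λ z → sumL (map f (g z))) zs)
sum-concatMap f g [] = refl
sum-concatMap f g (z ∷ zs) = begin
  sumL (map f (g z ++ concatMap g zs))              ≡⟨ cong sumL (map-++ f (g z) _) ⟩
  sumL (map f (g z) ++ map f (concatMap g zs))      ≡⟨ sum-++ (map f (g z)) _ ⟩
  sumL (map f (g z)) + sumL (map f (concatMap g zs)) ≡⟨ cong (sumL (map f (g z)) +_) (sum-concatMap f g zs) ⟩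
  _ ∎
  where open ≡-Reasoning

sum-replicate : (f : X → ℕ) (x : X) (r : ℕ) → sumL (map f (replicate r x)) ≡ r * f x
sum-replicate f x zero = refl
sum-replicate f x (suc r) = cong (f x +_) (sum-replicate f x r)

sum-tabulate : ∀ {n} (f : X → ℕ) (g : Fin n → X) → sumL (map f (tabulateL g)) ≡ sum (f ∘ g)
sum-tabulate {n = zero} f g = refl
sum-tabulate {n = suc n} f g = cong (f (g zero) +_) (sum-tabulate f (g ∘ suc))

length-concatMap≤ : ∀ (g : Z → List X) c → (∀ z → length (g z) ≤ c) → ∀ zs →
                    length (concatMap g zs) ≤ length zs * c
length-concatMap≤ g c h [] = z≤n
length-concatMap≤ g c h (z ∷ zs) = begin
  length (g z ++ concatMap g zs)           ≡⟨ length-++ (g z) ⟩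
  length (g z) + length (concatMap g zs)   ≤⟨ +-mono-≤ (h z) (length-concatMap≤ g c h zs) ⟩
  c + length zs * c                        ∎
  where open ≤-Reasoning

∈-concatMap : (g : Z → List X) {z : Z} {x : X} {zs : List Z} → z ∈ zs → x ∈ g z → x ∈ concatMap g zs
∈-concatMap g z∈ x∈ = ∈-concatMap⁺ g (lose z∈ x∈)

lookup-ext : ∀ {n} {u v : Vec X n} → (∀ i → lookup u i ≡ lookup v i) → u ≡ v
lookup-ext {u = u} {v} h = trans (sym (tabulate∘lookup u)) (trans (tabulate-cong h) (tabulate∘lookup v))

-- A factor (q , l , j) stands for the number of children with label l and index j of a vertex
-- of index q, where zero is the root and suc i a vertex entered through an edge of index i.
Factor : ℕ → ℕ → Set
Factor s S = Fin (suc S) × Fin s × Fin S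

module _ {s k : ℕ} {A B : Str s k} (ι : Emb A B) where

  ι-isEmb : IsEmb A B (emb ι)
  ι-isEmb = toWitness (isEmb ι)

  data Attached {n : ℕ} (ρ : Vec (Fin (size B)) n) (e : Fin (size B)) : Set where
    atRoot : parent B e ≡ e → Attached ρ e
    below  : ∀ i → parent B e ≡ lookup ρ i → Attached ρ e

  -- Enumerations of parent-closed sets of edges of B: the edges of A come last, and a new edge is put
  -- in front once its parent is enumerated.
  data Grow : ∀ {n} → Vec (Fin (size B)) n → Set where
    base : Grow (emb ι)
    step : ∀ {n} {ρ : Vec (Fin (size B)) n} → Grow ρ → (e : Fin (size B)) →
           (∀ i → lookup ρ i ≢ e) → Attached ρ e → Grow (e ∷ ρ)

  grow-injective : ∀ {n} {ρ : Vec (Fin (size B)) n} → Grow ρ → ∀ {i j} → lookup ρ i ≡ lookup ρ j → i ≡ j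
  grow-injective base eq = proj₁ ι-isEmb _ _ eq
  grow-injective (step G e fresh _) {zero} {zero} eq = refl
  grow-injective (step G e fresh _) {zero} {suc j} eq = contradiction (sym eq) (fresh j)
  grow-injective (step G e fresh _) {suc i} {zero} eq = contradiction eq (fresh i)
  grow-injective (step G e fresh _) {suc i} {suc j} eq = cong suc (grow-injective G eq)

  grow-closed : ∀ {n} {ρ : Vec (Fin (size B)) n} → Grow ρ → ∀ i → ∃[ j ] parent B (lookup ρ i) ≡ lookup ρ j
  grow-closed base i = parent A i , proj₂ (proj₂ ι-isEmb) i
  grow-closed (step G e _ (atRoot eq)) zero = zero , eq
  grow-closed (step G e _ (below j eq)) zero = suc j , eq
  grow-closed (step G e _ _) (suc i) with grow-closed G i
  ... | j , eq = suc j , eq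

  -- Climb from a missing edge towards the root. The first edge whose parent is enumerated, or else
  -- the edge leaving the root, can be added next; every edge passed on the way is itself missing.
  next : ∀ {n} (ρ : Vec (Fin (size B)) n) (i : ℕ) (e : Fin (size B)) → (∀ j → lookup ρ j ≢ e) →
         parent B (iter (parent B) i e) ≡ iter (parent B) i e →
         ∃[ e′ ] ((∀ j → lookup ρ j ≢ e′) × Attached ρ e′)
  next ρ zero e fresh fixed = e , fresh , atRoot fixed
  next ρ (suc i) e fresh fixed with any? (λ j → parent B e ≟F lookup ρ j)
  ... | yes (j , eq) = e , fresh , below j eq
  ... | no ¬att = next ρ i (parent B e) (λ j eq → ¬att (j , sym eq))
                    (subst (λ z → parent B z ≡ z) (sym (iter-shift (parent B) i e)) fixed)

  Full : Set
  Full = Σ[ n ∈ ℕ ] Σ[ ρ ∈ Vec (Fin (size B)) n ] (Grow ρ × (∀ e → ∃[ i ] lookup ρ i ≡ e))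

  complete : ∀ fuel {n} {ρ : Vec (Fin (size B)) n} → Grow ρ → n + fuel ≡ size B → Full
  complete fuel {n} {ρ} G eq with all? (λ e → any? (λ i → lookup ρ i ≟F e))
  ... | yes surj = n , ρ , G , surj
  complete fuel {n} {ρ} G eq | no ¬surj with any? (λ e → all? (λ i → ¬? (lookup ρ i ≟F e)))
  ... | no ¬missing = contradiction hit ¬surj
    where
    hit : ∀ e → ∃[ i ] lookup ρ i ≡ e
    hit e with any? (λ i → lookup ρ i ≟F e)
    ... | yes h = h
    ... | no ¬h = contradiction (e , λ i q → ¬h (i , q)) ¬missing
  ... | yes (e , fresh) with height B e
  ... | i , _ , fixed with next ρ i e fresh fixed
  -- Enumerations are injective, so once the fuel is spent a further edge would give `size B + 1`
  -- distinct edges of `B`.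
  complete zero {n} {ρ} G eq | no _ | yes _ | _ | e′ , fresh′ , att =
    contradiction (≤-trans (injective⇒≤ (grow-injective (step G e′ fresh′ att)))
                           (≤-reflexive (trans (sym eq) (+-identityʳ n)))) 1+n≰n
  complete (suc fuel) {n} {ρ} G eq | no _ | yes _ | _ | e′ , fresh′ , att =
    complete fuel (step G e′ fresh′ att) (trans (sym (+-suc n fuel)) eq)

  abstract
    full : Full
    full = complete (size B ∸ size A) base (m+[n∸m]≡n (injective⇒≤ (λ {i} {j} → proj₁ ι-isEmb i j)))

  module _ (S : ℕ) where

    spotIx : ∀ {n} {ρ : Vec (Fin (size B)) n} {e} → Attached ρ e → Vec (Fin S) n → Fin (suc S)
    spotIx (atRoot _) g = zero
    spotIx (below i _) g = suc (lookup g i)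

    SamePlace : ∀ {n} {ρ : Vec (Fin (size B)) n} {e} → Attached ρ e → Fin n → Set
    SamePlace {ρ = ρ} (atRoot _) i = parent B (lookup ρ i) ≡ lookup ρ i
    SamePlace {ρ = ρ} (below p _) i = parent B (lookup ρ i) ≡ lookup ρ p × i ≢ p

    samePlace? : ∀ {n} {ρ : Vec (Fin (size B)) n} {e} (a : Attached ρ e) i → Dec (SamePlace a i)
    samePlace? (atRoot _) i = _ ≟F _
    samePlace? (below _ _) i = (_ ≟F _) ×-dec ¬? (_ ≟F _)

    -- These are the enumerated edges whose images already occupy a place that the new edge could
    -- take if it has index `j`. They are described in `B` and by colours alone, so that their
    -- number does not depend on the embedding.
    Competitor : ∀ {n} {ρ : Vec (Fin (size B)) n} {e} → Attached ρ e → Vec (Fin S) n → Fin S → Fin n → Set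
    Competitor {ρ = ρ} {e} a g j i = SamePlace a i × label B (lookup ρ i) ≡ label B e × lookup g i ≡ j

    competitor? : ∀ {n} {ρ : Vec (Fin (size B)) n} {e} (a : Attached ρ e) g j i → Dec (Competitor a g j i)
    competitor? a g j i = samePlace? a i ×-dec (_ ≟F _) ×-dec (_ ≟F _)

    -- A new edge with index j can be placed in (Y + S) ∸ c = Y + (S ∸ c) ways, where c ≤ S counts the
    -- places already taken; the constant S ∸ c contributes that many copies of the old monomial.
    spare : ∀ {n} {ρ : Vec (Fin (size B)) n} {e} → Attached ρ e → Vec (Fin S) n → Fin S → ℕ
    spare a g j = S ∸ count {P = Competitor a g j} (competitor? a g j)

    choices : ∀ {n} {ρ : Vec (Fin (size B)) n} {e} → Attached ρ e →
              List (Factor s S) × Vec (Fin S) n → Fin S → List (List (Factor s S) × Vec (Fin S) (suc n))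
    choices {e = e} a (μ , g) j =
      ((spotIx a g , label B e , j) ∷ μ , j ∷ g) ∷ replicate (spare a g j) (μ , j ∷ g)

    -- A polynomial is a list of monomials with repetition, which encodes natural coefficients; each
    -- monomial is tagged with the colouring whose realisations it helps to count.
    growTerms : ∀ {n} {ρ : Vec (Fin (size B)) n} → Grow ρ →
                Vec (Fin S) (size A) → List (List (Factor s S) × Vec (Fin S) n)
    growTerms base h = ([] , h) ∷ []
    growTerms (step G e _ a) h = concatMap (λ x → concatMap (choices a x) (allFin S)) (growTerms G h)

    length-choices : ∀ {n} {ρ : Vec (Fin (size B)) n} {e} (a : Attached ρ e) x j → length (choices a x j) ≤ suc S
    length-choices a (μ , g) j =
      s≤s (≤-trans (≤-reflexive (length-replicate (spare a g j)))
                   (m∸n≤m S (count {P = Competitor a g j} (competitor? a g j))))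

    -- A new edge has `S` possible indices, and each turns a term into one term with a new factor
    -- and at most `S` spare copies. This bound is the origin of the constant `R`.
    length-growTerms : ∀ {n} {ρ : Vec (Fin (size B)) n} → .{{NonZero S}} →
                       (G : Grow ρ) → ∀ h → length (growTerms G h) ≤ (S * suc S) ^ n
    length-growTerms base h = m^n>0 (S * suc S) {{m*n≢0 S (suc S)}} (size A)
    length-growTerms {suc n} (step G e fresh a) h = begin
      length (growTerms (step G e fresh a) h)
        ≤⟨ length-concatMap≤ (λ x → concatMap (choices a x) (allFin S)) (S * suc S)
             (λ x → ≤-trans (length-concatMap≤ (choices a x) (suc S) (length-choices a x) (allFin S))
               (≤-reflexive (cong (_* suc S) (length-tabulate {n = S} id)))) (growTerms G h) ⟩
      length (growTerms G h) * (S * suc S)    ≤⟨ *-monoˡ-≤ (S * suc S) (length-growTerms G h) ⟩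
      (S * suc S) ^ n * (S * suc S)           ≡⟨ *-comm ((S * suc S) ^ n) _ ⟩
      (S * suc S) ^ suc n                     ∎
      where open ≤-Reasoning

    -- For injective `g` the factor identifies the edge `e` by its colour and records its label and
    -- its parent, or that it leaves the root.
    data IsFactor (g : Vec (Fin S) (size B)) (e : Fin (size B)) : Factor s S → Set where
      rootFactor  : parent B e ≡ e → IsFactor g e (zero , label B e , lookup g e)
      childFactor : parent B e ≢ e → IsFactor g e (suc (lookup g (parent B e)) , label B e , lookup g e)

    isFactor : ∀ {n} {ρ : Vec (Fin (size B)) n} → (G : Grow ρ) →
               ∀ {e} (fresh : ∀ i → lookup ρ i ≢ e) (a : Attached ρ e) g →
               IsFactor g e (spotIx a (mapV (lookup g) ρ) , label B e , lookup g e)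
    isFactor G fresh (atRoot eq) g = rootFactor eq
    isFactor {ρ = ρ} G {e} fresh (below i eq) g =
      subst (λ c → IsFactor g e (suc c , label B e , lookup g e))
            (sym (trans (lookup-map i (lookup g) ρ) (cong (lookup g) (sym eq))))
            (childFactor (λ q → fresh i (trans (sym eq) q)))

    choice⁻ : ∀ {n} {ρ : Vec (Fin (size B)) n} {e} (a : Attached ρ e) {μ g j x} → x ∈ choices a (μ , g) j →
              (proj₁ x ≡ (spotIx a g , label B e , j) ∷ μ ⊎ proj₁ x ≡ μ) × proj₂ x ≡ j ∷ g
    choice⁻ a (here refl) = inj₁ refl , refl
    choice⁻ a {μ} {g} {j} (there x∈) with All.lookup {P = _≡ (μ , j ∷ g)} (All.replicate⁺ (spare a g j) refl) x∈
    ... | refl = inj₂ refl , refl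

    -- Each step adds at most one factor, and a spare copy adds none, so the degree is at most the
    -- number of new edges. All terms are covered, whether or not `g` is injective.
    growTerm-sound : ∀ {n} {ρ : Vec (Fin (size B)) n} (G : Grow ρ) → ∀ h {μ} g →
      (μ , mapV (lookup g) ρ) ∈ growTerms G h →
      mapV (lookup g) (emb ι) ≡ h × size A + length μ ≤ n × (∀ {p} → p ∈ μ → ∃[ e ] IsFactor g e p)
    growTerm-sound base h g (here refl) = refl , ≤-reflexive (+-identityʳ _) , λ ()
    growTerm-sound (step {n} {ρ} G e fresh a) h {μ} g x∈
      with find (∈-concatMap⁻ (λ x → concatMap (choices a x) (allFin S)) {xs = growTerms G h} x∈)
    ... | (μ₀ , g₀) , x₀∈ , x∈′ with find (∈-concatMap⁻ (choices a (μ₀ , g₀)) {xs = allFin S} x∈′)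
    ... | j , _ , x∈″ with choice⁻ a x∈″
    ... | inj₁ refl , refl with growTerm-sound G h g x₀∈
    ... | h≡ , len , fac = h≡ , ≤-trans (≤-reflexive (+-suc (size A) _)) (s≤s len) ,
      λ { (here refl) → e , isFactor G fresh a g ; (there p∈) → fac p∈ }
    growTerm-sound (step G e fresh a) h g x∈ | _ , x₀∈ , _ | _ | inj₂ refl , refl
      with growTerm-sound G h g x₀∈
    ... | h≡ , len , fac = h≡ , m≤n⇒m≤1+n len , fac

    -- Taking the head of `choices` at every step avoids all spare copies, so every new edge leaves
    -- its factor and the degree bound is attained.
    growTerm-leading : ∀ {n} {ρ : Vec (Fin (size B)) n} (G : Grow ρ) → ∀ g →
      ∃[ μ ] ((μ , mapV (lookup g) ρ) ∈ growTerms G (mapV (lookup g) (emb ι)) × size A + length μ ≡ n ×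
              (∀ i → (∃[ a ] lookup ρ i ≡ lookup (emb ι) a) ⊎ (∃[ p ] (p ∈ μ × IsFactor g (lookup ρ i) p))))
    growTerm-leading base g = [] , here refl , +-identityʳ _ , λ i → inj₁ (i , refl)
    growTerm-leading (step {n} {ρ} G e fresh a) g with growTerm-leading G g
    ... | μ , μ∈ , len , fac =
      p ∷ μ ,
      ∈-concatMap (λ x → concatMap (choices a x) (allFin S)) μ∈
        (∈-concatMap (choices a _) (∈-allFin (lookup g e)) (here refl)) ,
      trans (+-suc (size A) _) (cong suc len) , fac′
      where
      p : Factor s S
      p = spotIx a (mapV (lookup g) ρ) , label B e , lookup g e
      fac′ : ∀ i → (∃[ b ] lookup (e ∷ ρ) i ≡ lookup (emb ι) b) ⊎
                   (∃[ q ] (q ∈ p ∷ μ × IsFactor g (lookup (e ∷ ρ) i) q))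
      fac′ zero = inj₂ (p , here refl , isFactor G fresh a g)
      fac′ (suc i) with fac i
      ... | inj₁ w = inj₁ w
      ... | inj₂ (q , q∈ , w) = inj₂ (q , there q∈ , w)

-- Counting partial embeddings into the input tree

module Counting (s S : ℕ) (k : ℕ) (weight : Factor s S → ℕ) where

  open Tree s S (λ q l j → S + weight (q , l , j))

  t : Str s k
  t = tree k

  E : Set
  E = Fin (size t)

  weightProduct : List (Factor s S) → ℕ
  weightProduct μ = product (map weight μ)

  termValue : ∀ {X : Set} → (X → ℕ) → List (Factor s S) × X → ℕ
  termValue F (μ , g) = weightProduct μ * F g

  total : ∀ {X : Set} → (X → ℕ) → List (List (Factor s S) × X) → ℕ
  total F xs = sumL (map (termValue F) xs)

  module _ {A B : Str s k} (ι : Emb A B) (α : Emb A t) where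

    α-isEmb : IsEmb A t (emb α)
    α-isEmb = toWitness (isEmb α)

    InPlace : ∀ {n} {ρ : Vec (Fin (size B)) n} {e} → Attached ι ρ e → Vec E n → E → Set
    InPlace (atRoot _) δ x = parent t x ≡ x
    InPlace (below p _) δ x = parent t x ≡ lookup δ p

    Admissible : ∀ {n} {ρ : Vec (Fin (size B)) n} {e} → Attached ι ρ e → Vec E n → E → Set
    Admissible {e = e} a δ x = (InPlace a δ x × label t x ≡ label B e) × (∀ i → lookup δ i ≢ x)

    -- `δ` lists the images of the edges listed by `ρ`: a partial embedding extending `α`, built one
    -- edge at a time.
    Realises : ∀ {n} {ρ : Vec (Fin (size B)) n} → Grow ι ρ → Vec E n → Set
    Realises base δ = δ ≡ emb α
    Realises (step G e _ a) (x ∷ δ) = Realises G δ × Admissible a δ x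

    admissible? : ∀ {n} {ρ : Vec (Fin (size B)) n} {e} (a : Attached ι ρ e) δ x → Dec (Admissible a δ x)
    admissible? {e = e} a δ x =
      (inPlace? a ×-dec (label t x ≟F label B e)) ×-dec all? (λ i → ¬? (lookup δ i ≟F x))
      where
      inPlace? : ∀ a → Dec (InPlace a δ x)
      inPlace? (atRoot _) = _ ≟F _
      inPlace? (below _ _) = _ ≟F _

    realises? : ∀ {n} {ρ : Vec (Fin (size B)) n} (G : Grow ι ρ) δ → Dec (Realises G δ)
    realises? base δ = ≡-dec _≟F_ δ (emb α)
    realises? (step G e _ a) (x ∷ δ) = realises? G δ ×-dec admissible? a δ x

    realises-injective : ∀ {n} {ρ : Vec (Fin (size B)) n} (G : Grow ι ρ) {δ} → Realises G δ →
                         ∀ {i j} → lookup δ i ≡ lookup δ j → i ≡ j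
    realises-injective base refl eq = proj₁ α-isEmb _ _ eq
    realises-injective (step G e _ a) {x ∷ δ} (r , _ , fresh) {zero} {zero} eq = refl
    realises-injective (step G e _ a) {x ∷ δ} (r , _ , fresh) {zero} {suc j} eq = contradiction (sym eq) (fresh j)
    realises-injective (step G e _ a) {x ∷ δ} (r , _ , fresh) {suc i} {zero} eq = contradiction eq (fresh i)
    realises-injective (step G e _ a) {x ∷ δ} (r , _) {suc i} {suc j} eq = cong suc (realises-injective G r eq)

    realises-label : ∀ {n} {ρ : Vec (Fin (size B)) n} (G : Grow ι ρ) {δ} → Realises G δ →
                     ∀ i → label t (lookup δ i) ≡ label B (lookup ρ i)
    realises-label base refl i = trans (proj₁ (proj₂ α-isEmb) i) (sym (proj₁ (proj₂ (ι-isEmb ι)) i))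
    realises-label (step G e _ a) {x ∷ δ} (_ , (_ , eq) , _) zero = eq
    realises-label (step G e _ a) {x ∷ δ} (r , _) (suc i) = realises-label G r i

    realises-parent : ∀ {n} {ρ : Vec (Fin (size B)) n} (G : Grow ι ρ) {δ} → Realises G δ →
                      ∀ i j → parent B (lookup ρ i) ≡ lookup ρ j → parent t (lookup δ i) ≡ lookup δ j
    realises-parent base refl i j eq = trans (proj₂ (proj₂ α-isEmb) i)
      (cong (lookup (emb α)) (proj₁ (ι-isEmb ι) _ _ (trans (sym (proj₂ (proj₂ (ι-isEmb ι)) i)) eq)))
    realises-parent (step G e fresh (atRoot _)) {x ∷ δ} (_ , (at , _) , _) zero zero eq = at
    realises-parent (step G e fresh (atRoot top)) {x ∷ δ} _ zero (suc j) eq =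
      contradiction (trans (sym eq) top) (fresh j)
    realises-parent (step G e fresh (below p pp)) {x ∷ δ} _ zero zero eq =
      contradiction (trans (sym pp) eq) (fresh p)
    realises-parent (step G e fresh (below p pp)) {x ∷ δ} (_ , (at , _) , _) zero (suc j) eq =
      trans at (cong (lookup δ) (grow-injective ι G (trans (sym pp) eq)))
    realises-parent (step G e fresh _) {x ∷ δ} _ (suc i) zero eq with grow-closed ι G i
    ... | j , eq′ = contradiction (trans (sym eq′) eq) (fresh j)
    realises-parent (step G e _ _) {x ∷ δ} (r , _) (suc i) (suc j) eq = realises-parent G r i j eq

    -- The enumerated set is closed under parents, so the true parent is also enumerated, and
    -- injectivity of `δ` identifies it with the given one.
    realises-parent⁻ : ∀ {n} {ρ : Vec (Fin (size B)) n} (G : Grow ι ρ) {δ} → Realises G δ →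
                       ∀ i j → parent t (lookup δ i) ≡ lookup δ j → parent B (lookup ρ i) ≡ lookup ρ j
    realises-parent⁻ {ρ = ρ} G r i j eq with grow-closed ι G i
    ... | j′ , eq′ = trans eq′ (cong (lookup ρ)
          (realises-injective G r (trans (sym (realises-parent G r i j′ eq′)) eq)))

    realises-iter : ∀ {n} {ρ : Vec (Fin (size B)) n} (G : Grow ι ρ) {δ} → Realises G δ → ∀ m i →
                    ∃[ j ] (iter (parent B) m (lookup ρ i) ≡ lookup ρ j × iter (parent t) m (lookup δ i) ≡ lookup δ j)
    realises-iter G r zero i = i , refl , refl
    realises-iter G r (suc m) i with realises-iter G r m i
    ... | j , eq , eq′ with grow-closed ι G j
    ... | j′ , eq″ = j′ , trans (cong (parent B) eq) eq″ ,
                     trans (cong (parent t) eq′) (realises-parent G r j j′ eq″)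

    module _ {n} {ρ : Vec (Fin (size B)) n} (G : Grow ι ρ) {δ : Vec E n} (r : Realises G δ)
             {e} (fresh : ∀ i → lookup ρ i ≢ e) (n≤S : n ≤ S) where

      -- Of the `S + weight` edges at the right place, with the right label and index, those already
      -- hit are lost. They number at most `n ≤ S`, so the subtraction is taken from `S` and leaves
      -- the weight intact.
      place-count : (a : Attached ι ρ e) → ∀ j → Refinement E (λ x → Admissible a δ x × ix x ≡ j) ↔
                    Fin (weight (spotIx ι S a (mapV ix δ) , label B e , j) + spare ι S a (mapV ix δ) j)
      place-count a j = via a
        where
        count-by : ∀ {P : E → Set} {w} (a : Attached ι ρ e) (P? : ∀ x → Dec (P x)) →
                   Refinement E P ↔ Fin (S + w) →
                   (∀ x → (Admissible a δ x × ix x ≡ j) ⇔ (P x × (∀ i → lookup δ i ≢ x))) →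
                   (∀ i → P (lookup δ i) ⇔ Competitor ι S a (mapV ix δ) j i) →
                   Refinement E (λ x → Admissible a δ x × ix x ≡ j) ↔ Fin (w + spare ι S a (mapV ix δ) j)
        count-by {P} {w} a P? φ adm⇔ comp⇔ =
          subst (λ z → Refinement E (λ x → Admissible a δ x × ix x ≡ j) ↔ Fin z) arith
                (count-missed P? (lookup δ) (realises-injective G r) φ ↔-∘ refinement-⇔ adm⇔)
          where
          comp? = competitor? ι S a (mapV ix δ) j
          c = count {P = Competitor ι S a (mapV ix δ) j} comp?
          arith : S + w ∸ count (P? ∘ lookup δ) ≡ w + (S ∸ c)
          arith = begin
            S + w ∸ count (P? ∘ lookup δ)
              ≡⟨ cong₂ _∸_ (+-comm S w) (count-⇔ (P? ∘ lookup δ) comp? comp⇔) ⟩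
            w + S ∸ c
              ≡⟨ +-∸-assoc w (≤-trans (count≤ {P = Competitor ι S a (mapV ix δ) j} comp?) n≤S) ⟩
            w + (S ∸ c) ∎
            where open ≡-Reasoning
        via : ∀ a → Refinement E (λ x → Admissible a δ x × ix x ≡ j) ↔
                    Fin (weight (spotIx ι S a (mapV ix δ) , label B e , j) + spare ι S a (mapV ix δ) j)
        via a@(atRoot top) = count-by a (rootSpot? k (label B e) j)
          (rootSpot-count (≤-trans z<s (proj₁ (proj₂ (height B e)))) (label B e) j)
          (λ x → mk⇔ (λ { (((at , l) , miss) , q) → (at , l , q) , miss })
                     (λ { ((at , l , q) , miss) → ((at , l) , miss) , q }))
          (λ i → mk⇔ (λ { (at , l , q) → realises-parent⁻ G r i i at ,
                                         trans (sym (realises-label G r i)) l , trans (lookup-map i ix δ) q })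
                     (λ { (at , l , q) → realises-parent G r i i at ,
                                         trans (realises-label G r i) l , trans (sym (lookup-map i ix δ)) q }))
        via a@(below p pp) with height B e
        ... | zero , _ , fixed = contradiction (trans (sym pp) fixed) (fresh p)
        -- From `e` an edge leaving the root is reached in `suc m` steps, hence from its parent in
        -- `m`; the same number of steps works for the image of the parent, which therefore is not
        -- on the lowest level.
        ... | suc m , m<k , fixed with realises-iter G r m p
        ... | q , eqB , eqT = count-by a (childSpot? k (lookup δ p) (label B e) j)
          (subst (λ z → Refinement E (ChildSpot k (lookup δ p) (label B e) j) ↔ Fin (S + weight (suc z , label B e , j)))
                 (sym (lookup-map p ix δ))
                 (childSpot-count (lookup δ p) m m<k (trans (cong (parent t) eqT) (trans at-q (sym eqT))) (label B e) j))
          (λ x → mk⇔ (λ { (((at , l) , miss) , q) → ((at , λ x≡ → miss p (sym x≡)) , l , q) , miss })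
                     (λ { (((at , _) , l , q) , miss) → ((at , l) , miss) , q }))
          (λ i → mk⇔ (λ { ((at , i≢) , l , q) → (realises-parent⁻ G r i p at , λ i≡p → i≢ (cong (lookup δ) i≡p)) ,
                                         trans (sym (realises-label G r i)) l , trans (lookup-map i ix δ) q })
                     (λ { ((at , i≢p) , l , q) → (realises-parent G r i p at , λ eq → i≢p (realises-injective G r eq)) ,
                                         trans (realises-label G r i) l , trans (sym (lookup-map i ix δ)) q }))
          where
          iter≡ : iter (parent B) (suc m) e ≡ lookup ρ q
          iter≡ = trans (sym (iter-shift (parent B) m e)) (trans (cong (iter (parent B) m) pp) eqB)
          at-q : parent t (lookup δ q) ≡ lookup δ q
          at-q = realises-parent G r q q (trans (cong (parent B) (sym iter≡)) (trans fixed iter≡))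

    choice-sum : ∀ {n} {ρ : Vec (Fin (size B)) n} {e} → Attached ι ρ e →
                 (Vec (Fin S) (suc n) → ℕ) → Vec (Fin S) n → ℕ
    choice-sum {e = e} a F g = sum (λ j → (weight (spotIx ι S a g , label B e , j) + spare ι S a g j) * F (j ∷ g))

    admissible-hasSum : ∀ {n} {ρ : Vec (Fin (size B)) n} (G : Grow ι ρ) {δ} → Realises G δ →
      ∀ {e} → (∀ i → lookup ρ i ≢ e) → (a : Attached ι ρ e) → n ≤ S → ∀ F →
      HasSum {Refinement E (Admissible a δ)} (λ x → F (ix (value x) ∷ mapV ix δ)) (choice-sum a F (mapV ix δ))
    admissible-hasSum G {δ} r {e} fresh a n≤S F =
      hasSum-↔ byIx (λ _ → refl)
        (hasSum-Σ (λ j → hasSum-const (F (j ∷ mapV ix δ)) (place-count G r fresh n≤S a j)) (hasSum-Fin _))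
      where
      byIx : Refinement E (Admissible a δ) ↔ Σ (Fin S) (λ j → Refinement E (λ x → Admissible a δ x × ix x ≡ j))
      byIx = mk↔ₛ′ (λ { (x , [ p ]) → ix x , x , [ (p , refl) ] }) (λ { (_ , x , [ p ]) → x , [ proj₁ p ] })
        (λ { (j , x , [ p ]) → lemma j x (recompute (ix x ≟F j) (proj₂ p)) p }) (λ _ → refl)
        where
        lemma : ∀ j x → ix x ≡ j → .(p : Admissible a δ x × ix x ≡ j) →
                _≡_ {A = Σ (Fin S) (λ j → Refinement E (λ x → Admissible a δ x × ix x ≡ j))}
                    (ix x , x , [ (proj₁ p , refl) ]) (j , x , [ p ])
        lemma _ x refl p = refl

    total-choices : ∀ {n} {ρ : Vec (Fin (size B)) n} {e} (a : Attached ι ρ e) F μ g →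
      total F (concatMap (choices ι S a (μ , g)) (allFin S)) ≡ termValue (choice-sum a F) (μ , g)
    total-choices {e = e} a F μ g = begin
      total F (concatMap (choices ι S a (μ , g)) (allFin S))
        ≡⟨ sum-concatMap (termValue F) (choices ι S a (μ , g)) (allFin S) ⟩
      sumL (map (total F ∘ choices ι S a (μ , g)) (allFin S))
        ≡⟨ sum-tabulate (total F ∘ choices ι S a (μ , g)) id ⟩
      sum (total F ∘ choices ι S a (μ , g))
        ≡⟨ sum-cong-≗ one ⟩
      sum (λ j → weightProduct μ * ((weight (spotIx ι S a g , label B e , j) + spare ι S a g j) * F (j ∷ g)))
        ≡⟨ *-distribˡ-sum (weightProduct μ)
             (λ j → (weight (spotIx ι S a g , label B e , j) + spare ι S a g j) * F (j ∷ g)) ⟨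
      termValue (choice-sum a F) (μ , g) ∎
      where
      open ≡-Reasoning
      open +-*-Solver
      one : ∀ j → total F (choices ι S a (μ , g) j) ≡
                  weightProduct μ * ((weight (spotIx ι S a g , label B e , j) + spare ι S a g j) * F (j ∷ g))
      one j = trans (cong (weight (spotIx ι S a g , label B e , j) * weightProduct μ * F (j ∷ g) +_)
                          (sum-replicate (termValue F) (μ , j ∷ g) (spare ι S a g j)))
                    (solve 4 (λ w p f r → w :* p :* f :+ r :* (p :* f) := p :* ((w :+ r) :* f)) refl
                       (weight (spotIx ι S a g , label B e , j)) (weightProduct μ) (F (j ∷ g)) (spare ι S a g j))

    -- The function `F` must be arbitrary for the induction: summing over the placements of the
    -- newest edge turns `F` into `choice-sum a F`, a function of the remaining colours.
    grow-hasSum : ∀ {n} {ρ : Vec (Fin (size B)) n} (G : Grow ι ρ) → n ≤ S → ∀ F →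
      HasSum {Refinement (Vec E n) (Realises G)} (F ∘ mapV ix ∘ value)
             (total F (growTerms ι S G (mapV ix (emb α))))
    grow-hasSum base _ F = subst (HasSum {Refinement (Vec E (size A)) (Realises base)} (F ∘ mapV ix ∘ value))
        (cong (_+ 0) (sym (+-identityʳ (F (mapV ix (emb α))))))
        (hasSum-↔ single (λ { (δ , [ p ]) → cong (F ∘ mapV ix) (recompute (realises? base δ) p) })
           (hasSum-Fin {1} (λ _ → F (mapV ix (emb α)))))
      where
      single : Refinement (Vec E (size A)) (Realises base) ↔ Fin 1
      single = mk↔ₛ′ (λ _ → zero) (λ _ → emb α , [ refl ]) (λ { zero → refl })
                 (λ { (δ , [ p ]) → refinement-≡ (sym (recompute (realises? base δ) p)) })
    grow-hasSum {suc n} (step {ρ = ρ} G e fresh a) n<S F =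
      subst (HasSum {Refinement (Vec E (suc n)) (Realises (step G e fresh a))} (F ∘ mapV ix ∘ value))
        (sym eq)
        (hasSum-↔ split (λ { (x ∷ δ , _) → refl })
           (hasSum-Σ {J = Refinement (Vec E n) (Realises G)} {K = λ δ → Refinement E (Admissible a (value δ))}
                     {f = λ δ x → F (ix (value x) ∷ mapV ix (value δ))}
              (λ { (δ , [ r ]) → admissible-hasSum G (recompute (realises? G δ) r) fresh a (<⇒≤ n<S) F })
              (grow-hasSum G (<⇒≤ n<S) (choice-sum a F))))
      where
      h = mapV ix (emb α)
      eq : total F (growTerms ι S (step G e fresh a) h) ≡ total (choice-sum a F) (growTerms ι S G h)
      eq = trans (sum-concatMap (termValue F) (λ x → concatMap (choices ι S a x) (allFin S)) (growTerms ι S G h))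
                 (cong sumL (map-cong (λ { (μ , g) → total-choices a F μ g }) (growTerms ι S G h)))
      split : Refinement (Vec E (suc n)) (Realises (step G e fresh a)) ↔
              Σ (Refinement (Vec E n) (Realises G)) (λ δ → Refinement E (Admissible a (value δ)))
      split = mk↔ₛ′ (λ { (x ∷ δ , [ p ]) → (δ , [ proj₁ p ]) , x , [ proj₂ p ] })
                    (λ { ((δ , [ p ]) , x , [ q ]) → x ∷ δ , [ (p , q) ] })
                    (λ _ → refl) (λ { (x ∷ δ , _) → refl })

-- Extensions of an embedding as realisations of a complete enumeration

module _ {s k : ℕ} {A B : Str s k} (ι : Emb A B) where

  order : Vec (Fin (size B)) (proj₁ (full ι))
  order = proj₁ (proj₂ (full ι))

  orderGrow : Grow ι order
  orderGrow = proj₁ (proj₂ (proj₂ (full ι)))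

  position : Fin (size B) → Fin (proj₁ (full ι))
  position e = proj₁ (proj₂ (proj₂ (proj₂ (full ι))) e)

  order-position : ∀ e → lookup order (position e) ≡ e
  order-position e = proj₂ (proj₂ (proj₂ (proj₂ (full ι))) e)

  position-order : ∀ i → position (lookup order i) ≡ i
  position-order i = grow-injective ι orderGrow (order-position (lookup order i))

  order-length≤ : proj₁ (full ι) ≤ size B
  order-length≤ = injective⇒≤ (grow-injective ι orderGrow)

  order-length≥ : size B ≤ proj₁ (full ι)
  order-length≥ = injective⇒≤ {f = position} λ {i} {j} eq →
    trans (sym (order-position i)) (trans (cong (lookup order) eq) (order-position j))

  -- Terms are generated in the order of growth, but the colours of a child must be indexed by its
  -- edges to serve as input for the next level of the pattern.
  unorder : ∀ {X : Set} → Vec X (proj₁ (full ι)) → Vec X (size B)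
  unorder g = tabulate (lookup g ∘ position)

  reorder : ∀ {X : Set} → Vec X (size B) → Vec X (proj₁ (full ι))
  reorder g = mapV (lookup g) order

  lookup-unorder : ∀ {X : Set} (g : Vec X _) i → lookup (unorder g) (lookup order i) ≡ lookup g i
  lookup-unorder g i = trans (lookup∘tabulate (lookup g ∘ position) (lookup order i))
                             (cong (lookup g) (position-order i))

  reorder-unorder : ∀ {X : Set} (g : Vec X _) → reorder (unorder g) ≡ g
  reorder-unorder g = lookup-ext λ i → trans (lookup-map i (lookup (unorder g)) order) (lookup-unorder g i)

  unorder-reorder : ∀ {X : Set} (g : Vec X _) → unorder (reorder g) ≡ g
  unorder-reorder g = lookup-ext λ e →
    trans (lookup∘tabulate (lookup (reorder g) ∘ position) e)
    (trans (lookup-map (position e) (lookup g) order) (cong (lookup g) (order-position e)))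

  unorder-map : ∀ {X Z : Set} (f : X → Z) g → unorder (mapV f g) ≡ mapV f (unorder g)
  unorder-map f g = lookup-ext λ e →
    trans (lookup∘tabulate (lookup (mapV f g) ∘ position) e)
    (trans (lookup-map (position e) f g)
    (sym (trans (lookup-map e f (unorder g)) (cong f (lookup∘tabulate (lookup g ∘ position) e)))))

  module _ (S : ℕ) where

    unorderTerm : List (Factor s S) × Vec (Fin S) (proj₁ (full ι)) →
                  List (Factor s S) × Vec (Fin S) (size B)
    unorderTerm (μ , g) = μ , unorder g

    abstract
      terms : Vec (Fin S) (size A) → List (List (Factor s S) × Vec (Fin S) (size B))
      terms h = map unorderTerm (growTerms ι S orderGrow h)

      terms≡ : ∀ h → terms h ≡ map unorderTerm (growTerms ι S orderGrow h)
      terms≡ h = refl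

    length-terms : .{{_ : NonZero S}} → size B ≤ S → ∀ h → length (terms h) ≤ (S * suc S) ^ S
    length-terms B≤S h = begin
      length (terms h)                    ≡⟨ cong length (terms≡ h) ⟩
      length (map unorderTerm (growTerms ι S orderGrow h)) ≡⟨ length-map unorderTerm (growTerms ι S orderGrow h) ⟩
      length (growTerms ι S orderGrow h)  ≤⟨ length-growTerms ι S orderGrow h ⟩
      (S * suc S) ^ proj₁ (full ι)        ≤⟨ ^-monoʳ-≤ (S * suc S) {{m*n≢0 S (suc S)}} (≤-trans order-length≤ B≤S) ⟩
      (S * suc S) ^ S                     ∎
      where open ≤-Reasoning

    term-sound : ∀ h {μ g} → (μ , g) ∈ terms h →
      mapV (lookup g) (emb ι) ≡ h × size A + length μ ≤ size B × (∀ {p} → p ∈ μ → ∃[ e ] IsFactor ι S g e p)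
    term-sound h x∈ with ∈-map⁻ unorderTerm (subst (_ ∈_) (terms≡ h) x∈)
    ... | (μ , g) , y∈ , refl
      with growTerm-sound ι S orderGrow h (unorder g)
             (subst (λ z → (μ , z) ∈ growTerms ι S orderGrow h) (sym (reorder-unorder g)) y∈)
    ... | h≡ , len , fac = h≡ , ≤-trans len order-length≤ , fac

    term-leading : ∀ g → ∃[ μ ] ((μ , g) ∈ terms (mapV (lookup g) (emb ι)) × size A + length μ ≡ size B ×
                   (∀ e → (∃[ a ] e ≡ lookup (emb ι) a) ⊎ (∃[ p ] (p ∈ μ × IsFactor ι S g e p))))
    term-leading g with growTerm-leading ι S orderGrow g
    ... | μ , μ∈ , len , fac =
      μ ,
      subst ((μ , g) ∈_) (sym (terms≡ _))
        (subst (λ z → (μ , z) ∈ map unorderTerm (growTerms ι S orderGrow (mapV (lookup g) (emb ι))))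
               (unorder-reorder g) (∈-map⁺ unorderTerm μ∈)) ,
      trans len (≤-antisym order-length≤ order-length≥) ,
      λ e → subst (λ z → (∃[ a ] z ≡ lookup (emb ι) a) ⊎ (∃[ p ] (p ∈ μ × IsFactor ι S g z p)))
                  (order-position e) (fac (position e))

emb-≡ : ∀ {s k} {A B : Str s k} {β γ : Emb A B} → emb β ≡ emb γ → β ≡ γ
emb-≡ {A = A} {B} {β = v , p} {.v , q} refl = cong (v ,_) (T-irrelevant p q)

extension-≡ : ∀ {s k} {A B T : Str s k} {ι : Emb A B} {α : Emb A T}
              {x y : Σ[ β ∈ Emb B T ] Extends ι β α} →
              emb (proj₁ x) ≡ emb (proj₁ y) → x ≡ y
extension-≡ {x = β , p} {γ , q} eq with emb-≡ {β = β} {γ} eq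
... | refl = cong (β ,_) (uip p q)

module CountingExtensions (s S k : ℕ) (weight : Factor s S → ℕ) where

  open Counting s S k weight
  open Tree s S (λ q l j → S + weight (q , l , j)) using (ix)

  colour : ∀ {A : Str s k} → Emb A t → Vec (Fin S) (size A)
  colour α = mapV ix (emb α)

  module _ {A B : Str s k} (ι : Emb A B) (α : Emb A t) where

    order-realises : ∀ {n} {ρ : Vec (Fin (size B)) n} (G : Grow ι ρ) (β : Emb B t) → Extends ι β α →
                     Realises ι α G (mapV (lookup (emb β)) ρ)
    order-realises base β ext = ext
    order-realises (step {ρ = ρ} G e fresh a) β ext =
      order-realises G β ext , (inPlace a , proj₁ (proj₂ β-isEmb) e) ,
      λ i eq → fresh i (proj₁ β-isEmb _ _ (trans (sym (lookup-map i (lookup (emb β)) ρ)) eq))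
      where
      β-isEmb : IsEmb B t (emb β)
      β-isEmb = toWitness (isEmb β)
      inPlace : ∀ a → InPlace ι α a (mapV (lookup (emb β)) ρ) (lookup (emb β) e)
      inPlace (atRoot eq) = trans (proj₂ (proj₂ β-isEmb) e) (cong (lookup (emb β)) eq)
      inPlace (below p eq) = trans (proj₂ (proj₂ β-isEmb) e)
        (trans (cong (lookup (emb β)) eq) (sym (lookup-map p (lookup (emb β)) ρ)))

    realisation-base : ∀ {n} {ρ : Vec (Fin (size B)) n} (G : Grow ι ρ) {δ} → Realises ι α G δ → ∀ a →
                       ∃[ i ] (lookup ρ i ≡ lookup (emb ι) a × lookup δ i ≡ lookup (emb α) a)
    realisation-base base refl a = a , refl , refl
    realisation-base (step G e _ _) {x ∷ δ} (r , _) a with realisation-base G r a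
    ... | i , eq , eq′ = suc i , eq , eq′

    extensions↔ : (Σ[ β ∈ Emb B t ] Extends ι β α) ↔
                  Refinement (Vec E (proj₁ (full ι))) (Realises ι α (orderGrow ι))
    extensions↔ = bijective⇒↔ f inj surj
      where
      f : (Σ[ β ∈ Emb B t ] Extends ι β α) → Refinement (Vec E (proj₁ (full ι))) (Realises ι α (orderGrow ι))
      f (β , ext) = reorder ι (emb β) , [ order-realises (orderGrow ι) β ext ]
      inj : ∀ {x y} → f x ≡ f y → x ≡ y
      inj {β , _} {γ , _} eq = extension-≡ {ι = ι} {α}
        (trans (sym (unorder-reorder ι (emb β))) (trans (cong (unorder ι ∘ value) eq) (unorder-reorder ι (emb γ))))
      surj : ∀ y → ∃[ x ] f x ≡ y
      surj (δ , [ r′ ]) = ((v , fromWitness v-isEmb) , ext) , refinement-≡ (reorder-unorder ι δ)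
        where
        r : Realises ι α (orderGrow ι) δ
        r = recompute (realises? ι α (orderGrow ι) δ) r′
        v = unorder ι δ
        at : ∀ e → lookup v e ≡ lookup δ (position ι e)
        at e = lookup∘tabulate (lookup δ ∘ position ι) e
        v-isEmb : IsEmb B t v
        v-isEmb = (λ i j eq → trans (sym (order-position ι i)) (trans
                     (cong (lookup (order ι)) (realises-injective ι α (orderGrow ι) r
                       (trans (sym (at i)) (trans eq (at j)))))
                     (order-position ι j))) ,
                  (λ e → trans (cong (label t) (at e)) (trans (realises-label ι α (orderGrow ι) r (position ι e))
                     (cong (label B) (order-position ι e)))) ,
                  (λ e → trans (cong (parent t) (at e)) (trans
                     (realises-parent ι α (orderGrow ι) r (position ι e) (position ι (parent B e))
                       (trans (cong (parent B) (order-position ι e)) (sym (order-position ι (parent B e)))))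
                     (sym (at (parent B e)))))
        ext : mapV (lookup v) (emb ι) ≡ emb α
        ext = lookup-ext λ a → trans (lookup-map a (lookup v) (emb ι)) (go a (realisation-base (orderGrow ι) r a))
          where
          go : ∀ a → ∃[ i ] (lookup (order ι) i ≡ lookup (emb ι) a × lookup δ i ≡ lookup (emb α) a) →
               lookup v (lookup (emb ι) a) ≡ lookup (emb α) a
          go a (i , eq , eq′) = trans (cong (lookup v) (sym eq)) (trans (lookup-unorder ι δ i) eq′)

    extensions-hasSum : size B ≤ S → ∀ (F : Vec (Fin S) (size B) → ℕ) →
      HasSum {Σ[ β ∈ Emb B t ] Extends ι β α} (F ∘ colour ∘ proj₁) (total F (terms ι S (colour α)))
    extensions-hasSum B≤S F =
      subst (HasSum {Σ[ β ∈ Emb B t ] Extends ι β α} (F ∘ colour ∘ proj₁))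
        (sym (trans (cong (total F) (terms≡ ι S (colour α)))
                    (cong sumL (sym (mapL-∘ {g = termValue F} {f = unorderTerm ι S}
                                           (growTerms ι S (orderGrow ι) (colour α)))))))
        (hasSum-↔ extensions↔
          (λ { (β , ext) → cong F (trans (cong (mapV ix) (sym (unorder-reorder ι (emb β))))
                                         (sym (unorder-map ι ix (reorder ι (emb β))))) })
          (grow-hasSum ι α (orderGrow ι) (≤-trans (order-length≤ ι) B≤S) (F ∘ unorder ι)))

-- Codes of output trees

term≤sum : ∀ {n} (f : Fin n → ℕ) i → f i ≤ sum f
term≤sum f zero = m≤m+n _ _
term≤sum f (suc i) = ≤-trans (term≤sum (f ∘ suc) i) (m≤n+m _ _)

-- It dominates every number of children in the pattern and every label size below the root, so a
-- single `S` serves all levels.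
bound : ∀ {s k} {A : Str s k} → PTree A → ℕ
bound (node c B ι sub) = c + sum (λ i → size (B i) + bound (sub i))

children≤bound : ∀ {s k} {A : Str s k} c (B : Fin c → Str s k) (ι : ∀ i → Emb A (B i)) sub →
                 c ≤ bound (node c B ι sub)
children≤bound c B ι sub = m≤m+n _ _

childSize≤bound : ∀ {s k} {A : Str s k} c (B : Fin c → Str s k) (ι : ∀ i → Emb A (B i)) sub i →
                  size (B i) + bound (sub i) ≤ bound (node c B ι sub)
childSize≤bound c B ι sub i = ≤-trans (term≤sum (λ i → size (B i) + bound (sub i)) i) (m≤n+m _ c)

-- A relation and not a function, because the children of a `UTree` are indexed by an arbitrary
-- type; finiteness enters through `HasSum`.
data HasCode (q : ℕ) : UTree → ℕ → Set₁ where
  node : ∀ {I f n} (u : I → ℕ) → (∀ i → HasCode q (f i) (u i)) →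
         HasSum (λ i → q ^ u i) n → HasCode q (node I f) n

hasCode-unique : ∀ {q T U m n} → T ≅ᵘ U → HasCode q T m → HasCode q U n → m ≡ n
hasCode-unique {q} (node π iso) (node u cs p) (node v ds r) =
  hasSum-unique p (hasSum-↔ π (λ i → cong (q ^_) (hasCode-unique (iso i) (cs i) (ds _))) r)

iso-sym : ∀ {s k} {A B : Str s k} → Iso A B → Iso B A
iso-sym {A = A} {B} σ = record
  { bij = ↔-sym (Iso.bij σ)
  ; to-label = λ e → trans (sym (Iso.to-label σ (from e))) (cong (label B) (strictlyInverseˡ e))
  ; to-parent = λ e → trans (sym (strictlyInverseʳ _)) (cong from
      (trans (sym (Iso.to-parent σ (from e))) (cong (parent B) (strictlyInverseˡ e)))) }
  where open Inverse (Iso.bij σ) using (from; strictlyInverseˡ; strictlyInverseʳ)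

iso-from : ∀ {s k} {A B : Str s k} → Iso A B → Fin (size B) → Fin (size A)
iso-from σ = Inverse.from (Iso.bij σ)

from-to : ∀ {s k} {A B : Str s k} (σ : Iso A B) e → iso-from σ (Iso.to σ e) ≡ e
from-to σ = Inverse.strictlyInverseʳ (Iso.bij σ)

to-from : ∀ {s k} {A B : Str s k} (σ : Iso A B) e → Iso.to σ (iso-from σ e) ≡ e
to-from σ = Inverse.strictlyInverseˡ (Iso.bij σ)

transport : ∀ {s k} {A B T : Str s k} → Iso A B → Emb A T → Emb B T
transport {A = A} {B} {T} σ α = v , fromWitness
  ( (λ i j eq → trans (sym (to-from σ i)) (trans (cong (Iso.to σ)
       (proj₁ α-isEmb _ _ (trans (sym (at i)) (trans eq (at j))))) (to-from σ j)))
  , (λ e → trans (cong (label T) (at e)) (trans (proj₁ (proj₂ α-isEmb) _) (Iso.to-label (iso-sym σ) e)))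
  , (λ e → trans (cong (parent T) (at e)) (trans (proj₂ (proj₂ α-isEmb) _)
       (trans (cong (lookup (emb α)) (Iso.to-parent (iso-sym σ) e)) (sym (at (parent B e)))))) )
  where
  α-isEmb : IsEmb A T (emb α)
  α-isEmb = toWitness (isEmb α)
  v = tabulate (lookup (emb α) ∘ iso-from σ)
  at : ∀ e → lookup v e ≡ lookup (emb α) (iso-from σ e)
  at = lookup∘tabulate (lookup (emb α) ∘ iso-from σ)

lookup-transport : ∀ {s k} {A B T : Str s k} (σ : Iso A B) (α : Emb A T) e →
                   lookup (emb (transport σ α)) e ≡ lookup (emb α) (iso-from σ e)
lookup-transport σ α = lookup∘tabulate (lookup (emb α) ∘ iso-from σ)

transport-extensions : ∀ {s k} {A A′ B B′ T : Str s k} {ι : Emb A B} {ι′ : Emb A′ B′}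
  (τ : Iso A A′) (σ : Iso B B′) → (∀ a → Iso.to σ (lookup (emb ι) a) ≡ lookup (emb ι′) (Iso.to τ a)) →
  (α : Emb A T) → (Σ[ β ∈ Emb B T ] Extends ι β α) ↔ (Σ[ β ∈ Emb B′ T ] Extends ι′ β (transport τ α))
transport-extensions {A = A} {A′} {B} {B′} {T} {ι} {ι′} τ σ ext α =
  mk↔ₛ′ (λ (β , p) → transport σ β , extends⁺ {β} p) (λ (β , p) → transport (iso-sym σ) β , extends⁻ {β} p)
    (λ (β , p) → extension-≡ {ι = ι′} {transport τ α} (lookup-ext λ e →
      trans (lookup-transport σ (transport (iso-sym σ) β) e)
      (trans (lookup-transport (iso-sym σ) β _) (cong (lookup (emb β)) (to-from σ e)))))
    (λ (β , p) → extension-≡ {ι = ι} {α} (lookup-ext λ e →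
      trans (lookup-transport (iso-sym σ) (transport σ β) e)
      (trans (lookup-transport σ β _) (cong (lookup (emb β)) (from-to σ e)))))
  where
  open ≡-Reasoning
  extends⁺ : ∀ {β} → Extends ι β α → Extends ι′ (transport σ β) (transport τ α)
  extends⁺ {β} p = lookup-ext λ a → begin
    lookup (mapV (lookup (emb (transport σ β))) (emb ι′)) a ≡⟨ lookup-map a _ (emb ι′) ⟩
    lookup (emb (transport σ β)) (lookup (emb ι′) a)        ≡⟨ lookup-transport σ β _ ⟩
    lookup (emb β) (iso-from σ (lookup (emb ι′) a))
      ≡⟨ cong (lookup (emb β)) (trans (cong (iso-from σ)
           (trans (cong (lookup (emb ι′)) (sym (to-from τ a))) (sym (ext _)))) (from-to σ _)) ⟩
    lookup (emb β) (lookup (emb ι) (iso-from τ a))          ≡⟨ lookup-map (iso-from τ a) (lookup (emb β)) (emb ι) ⟨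
    lookup (mapV (lookup (emb β)) (emb ι)) (iso-from τ a)   ≡⟨ cong (λ v → lookup v (iso-from τ a)) p ⟩
    lookup (emb α) (iso-from τ a)                           ≡⟨ lookup-transport τ α a ⟨
    lookup (emb (transport τ α)) a                          ∎
  extends⁻ : ∀ {β} → Extends ι′ β (transport τ α) → Extends ι (transport (iso-sym σ) β) α
  extends⁻ {β} p = lookup-ext λ a → begin
    lookup (mapV (lookup (emb (transport (iso-sym σ) β))) (emb ι)) a ≡⟨ lookup-map a _ (emb ι) ⟩
    lookup (emb (transport (iso-sym σ) β)) (lookup (emb ι) a)        ≡⟨ lookup-transport (iso-sym σ) β _ ⟩
    lookup (emb β) (Iso.to σ (lookup (emb ι) a))            ≡⟨ cong (lookup (emb β)) (ext a) ⟩
    lookup (emb β) (lookup (emb ι′) (Iso.to τ a))           ≡⟨ lookup-map (Iso.to τ a) (lookup (emb β)) (emb ι′) ⟨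
    lookup (mapV (lookup (emb β)) (emb ι′)) (Iso.to τ a)    ≡⟨ cong (λ v → lookup v (Iso.to τ a)) p ⟩
    lookup (emb (transport τ α)) (Iso.to τ a)               ≡⟨ lookup-transport τ α _ ⟩
    lookup (emb α) (iso-from τ (Iso.to τ a))                ≡⟨ cong (lookup (emb α)) (from-to τ a) ⟩
    lookup (emb α) a                                        ∎

module Codes (s k S : ℕ) .{{_ : NonZero S}} where

  -- D is the base packing monomials into exponents, W exceeds every packed monomial, and R exceeds
  -- the number of terms contributed by all children of a node.
  D indexBound : ℕ
  D = suc S
  indexBound = suc S * (s * S)

  abstract
    W R : ℕ
    W = suc (S * D ^ indexBound)
    R = suc (S * (S * suc S) ^ S)

    W≡ : W ≡ suc (S * D ^ indexBound)
    W≡ = refl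

    R≡ : R ≡ suc (S * (S * suc S) ^ S)
    R≡ = refl

  instance
    R≢0 : NonZero R
    R≢0 = subst NonZero (sym R≡) _

  factorIndex : Factor s S → ℕ
  factorIndex (q , l , j) = toℕ (combine q (combine l j))

  factorIndex-injective : ∀ {p p′} → factorIndex p ≡ factorIndex p′ → p ≡ p′
  factorIndex-injective {q , l , j} {q′ , l′ , j′} eq
    with combine-injective q (combine l j) q′ (combine l′ j′) (toℕ-injective eq)
  ... | refl , eq′ with combine-injective l j l′ j′ eq′
  ... | refl , refl = refl

  monomialCode : List (Factor s S) → ℕ
  monomialCode μ = powerSum D (map factorIndex μ)

  monomialCode<W : ∀ μ → length μ ≤ S → monomialCode μ < W
  monomialCode<W μ len = subst (monomialCode μ <_) (sym W≡) (s≤s (≤-trans (go μ) (*-monoˡ-≤ (D ^ indexBound) len)))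
    where
    go : ∀ μ → monomialCode μ ≤ length μ * D ^ indexBound
    go [] = z≤n
    go (p@(q , l , j) ∷ μ) = +-mono-≤ (^-monoʳ-≤ D (<⇒≤ (toℕ<n (combine q (combine l j))))) (go μ)

  -- A product of weights is `R` raised to a numeral in base `D` whose digits are the multiplicities
  -- of the factors. A monomial of degree at most `S` has digits below `D`, so it can be read off.
  weight : Factor s S → ℕ
  weight p = R ^ (D ^ factorIndex p)

  open Counting s S k weight
  open CountingExtensions s S k weight
  open Tree s S (λ q l j → S + weight (q , l , j)) using (ix)

  weightProduct≡ : ∀ μ → weightProduct μ ≡ R ^ monomialCode μ
  weightProduct≡ [] = refl
  weightProduct≡ (p ∷ μ) = trans (cong (weight p *_) (weightProduct≡ μ))
    (sym (^-distribˡ-+-* R (D ^ factorIndex p) (monomialCode μ)))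

  -- Subtree codes are exponents of `R ^ W`, itself a power of `R`, so a monomial times the power
  -- for a subtree is again a single power of `R`.
  exponent : ∀ {X : Set} → (X → ℕ) → List (Factor s S) × X → ℕ
  exponent F (μ , g) = monomialCode μ + F g * W

  contribution : ∀ {A B : Str s k} → Emb A B → (Vec (Fin S) (size B) → ℕ) → Vec (Fin S) (size A) → ℕ
  contribution ι F h = powerSum R (map (exponent F) (terms ι S h))

  -- No embedding occurs here; `eval-hasCode` shows that this is the code of the output subtree at
  -- any embedding with colouring `h`.
  code : ∀ {A : Str s k} → PTree A → Vec (Fin S) (size A) → ℕ
  code (node c B ι sub) h = sum (λ i → contribution (ι i) (code (sub i)) h)

  contribution-hasSum : ∀ {A B : Str s k} (ι : Emb A B) (α : Emb A t) → size B ≤ S → ∀ F →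
    HasSum {Σ[ β ∈ Emb B t ] Extends ι β α} (λ (β , _) → (R ^ W) ^ F (colour β)) (contribution ι F (colour α))
  contribution-hasSum ι α B≤S F =
    subst (HasSum (λ (β , _) → (R ^ W) ^ F (colour β)))
          (trans (cong sumL (map-cong value≡ (terms ι S (colour α)))) (cong sumL (mapL-∘ (terms ι S (colour α)))))
          (extensions-hasSum ι α B≤S (λ g → (R ^ W) ^ F g))
    where
    open ≡-Reasoning
    value≡ : ∀ x → termValue (λ g → (R ^ W) ^ F g) x ≡ R ^ exponent F x
    value≡ (μ , g) = begin
      weightProduct μ * (R ^ W) ^ F g      ≡⟨ cong₂ _*_ (weightProduct≡ μ) (^-*-assoc R W (F g)) ⟩
      R ^ monomialCode μ * R ^ (W * F g)   ≡⟨ cong (λ z → R ^ monomialCode μ * R ^ z) (*-comm W (F g)) ⟩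
      R ^ monomialCode μ * R ^ (F g * W)   ≡⟨ ^-distribˡ-+-* R (monomialCode μ) (F g * W) ⟨
      R ^ exponent F (μ , g)               ∎

  eval-hasCode : ∀ {A : Str s k} (Φ : PTree A) → bound Φ ≤ S → (α : Emb A t) →
                 HasCode (R ^ W) (eval Φ t α) (code Φ (colour α))
  eval-hasCode (node c B ι sub) b α = node (λ { (i , β , _) → code (sub i) (colour β) })
    (λ { (i , β , _) → eval-hasCode (sub i) (≤-trans (m≤n+m _ (size (B i))) (b′ i)) β })
    (hasSum-↔ (↔-id _) (λ { (i , β , _) → refl })
      (hasSum-Σ {K = λ i → Σ[ β ∈ Emb (B i) t ] Extends (ι i) β α}
                {f = λ i (β , _) → (R ^ W) ^ code (sub i) (colour β)}
        (λ i → contribution-hasSum (ι i) α (≤-trans (m≤m+n _ _) (b′ i)) (code (sub i))) (hasSum-Fin _)))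
    where
    b′ : ∀ i → size (B i) + bound (sub i) ≤ S
    b′ i = ≤-trans (childSize≤bound c B ι sub i) b

  -- Embeddings of `A` are extensions of the empty one. Counting those coloured by `h`, with an
  -- indicator for `F`, gives a sum containing the leading term for `h`, which is a power of `R` and
  -- hence positive.
  colouring-realised : ∀ {A : Str s k} → size A ≤ S → (h : Vec (Fin S) (size A)) → ∃[ α ] colour {A} α ≡ h
  colouring-realised {A} A≤S h with term-leading (emptyEmb A) S h
  ... | μ , μ∈ , _ = pick (Inverse.from φ (subst Fin (suc-pred _ {{>-nonZero positive}}) zero))
    where
    F : Vec (Fin S) (size A) → ℕ
    F g = indicator (≡-dec _≟F_ g h)
    φ : HasSum {Σ[ β ∈ Emb A t ] Extends (emptyEmb A) β (emptyEmb t)} (F ∘ colour ∘ proj₁)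
               (total F (terms (emptyEmb A) S []))
    φ = extensions-hasSum (emptyEmb A) (emptyEmb t) A≤S F
    Fh : F h ≡ 1
    Fh with ≡-dec _≟F_ h h
    ... | yes _ = refl
    ... | no ¬p = contradiction refl ¬p
    positive : 0 < total F (terms (emptyEmb A) S [])
    positive = begin
      1                          ≤⟨ m^n>0 R (monomialCode μ) ⟩
      R ^ monomialCode μ         ≡⟨ weightProduct≡ μ ⟨
      weightProduct μ            ≡⟨ *-identityʳ _ ⟨
      weightProduct μ * 1        ≡⟨ cong (weightProduct μ *_) Fh ⟨
      weightProduct μ * F h      ≤⟨ ∈⇒≤sum (∈-map⁺ (termValue F) μ∈) ⟩
      total F (terms (emptyEmb A) S []) ∎
      where open ≤-Reasoning
    pick : Σ (Σ[ β ∈ Emb A t ] Extends (emptyEmb A) β (emptyEmb t)) (Fin ∘ F ∘ colour ∘ proj₁) →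
           ∃[ α ] colour {A} α ≡ h
    pick ((β , _) , x) with ≡-dec _≟F_ (colour β) h
    pick ((β , _) , x) | yes eq = β , eq

  colour-transport : ∀ {A A′ : Str s k} (τ : Iso A A′) (α : Emb A t) a →
                     lookup (colour (transport τ α)) (Iso.to τ a) ≡ lookup (colour α) a
  colour-transport τ α a = trans (lookup-map _ ix (emb (transport τ α)))
    (trans (cong ix (trans (lookup-transport τ α _) (cong (lookup (emb α)) (from-to τ a))))
           (sym (lookup-map a ix (emb α))))

  -- Comparing the two term lists directly would be awkward, as they depend on the chosen
  -- enumerations. Instead `h` is realised by an embedding, and both sides become cardinalities of
  -- sets of extensions that `transport` puts in bijection.
  contribution-invariant : ∀ {A A′ B B′ : Str s k} (ι : Emb A B) (ι′ : Emb A′ B′) (τ : Iso A A′) (σ : Iso B B′) →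
    (∀ a → Iso.to σ (lookup (emb ι) a) ≡ lookup (emb ι′) (Iso.to τ a)) →
    size A ≤ S → size B ≤ S → size B′ ≤ S → ∀ F F′ →
    (∀ g g′ → (∀ e → lookup g′ (Iso.to σ e) ≡ lookup g e) → F g ≡ F′ g′) →
    ∀ h h′ → (∀ a → lookup h′ (Iso.to τ a) ≡ lookup h a) →
    contribution ι F h ≡ contribution ι′ F′ h′
  contribution-invariant {A} {A′} {B} {B′} ι ι′ τ σ ext A≤S B≤S B′≤S F F′ F≡ h h′ h≡ = go (colouring-realised A≤S h)
    where
    go : ∃[ α ] colour {A} α ≡ h → contribution ι F h ≡ contribution ι′ F′ h′
    go (α , α≡) = begin
      contribution ι F h                             ≡⟨ cong (contribution ι F) α≡ ⟨
      contribution ι F (colour α)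
        ≡⟨ hasSum-unique (contribution-hasSum ι α B≤S F)
             (hasSum-↔ {f = λ (β , _) → (R ^ W) ^ F (colour β)} {g = λ (β , _) → (R ^ W) ^ F′ (colour β)}
                (transport-extensions {ι = ι} {ι′} τ σ ext α)
                (λ (β , _) → cong ((R ^ W) ^_) (F≡ (colour β) (colour (transport σ β)) (colour-transport σ β)))
                (contribution-hasSum ι′ (transport τ α) B′≤S F′)) ⟩
      contribution ι′ F′ (colour (transport τ α))    ≡⟨ cong (contribution ι′ F′) colour≡ ⟩
      contribution ι′ F′ h′                          ∎
      where
      open ≡-Reasoning
      colour≡ : colour (transport τ α) ≡ h′
      colour≡ = lookup-ext λ a → trans (cong (lookup (colour (transport τ α))) (sym (to-from τ a)))
        (trans (colour-transport τ α _) (trans (cong (λ v → lookup v (iso-from τ a)) α≡)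
        (trans (sym (h≡ _)) (cong (lookup h′) (to-from τ a)))))

-- Matching children and injective colourings

injective⇒surjective : ∀ {m n} (f : Fin m → Fin n) → (∀ {i j} → f i ≡ f j → i ≡ j) → n ≤ m →
                       ∀ y → ∃[ x ] f x ≡ y
injective⇒surjective {m} {n} f f-inj n≤m y with any? (λ x → f x ≟F y)
... | yes hit = hit
... | no ¬hit = contradiction (≤-trans (injective⇒≤ {f = g} g-inj) n≤m) 1+n≰n
  where
  g : Fin (suc m) → Fin n
  g zero = y
  g (suc i) = f i
  g-inj : ∀ {i j} → g i ≡ g j → i ≡ j
  g-inj {zero} {zero} _ = refl
  g-inj {zero} {suc j} eq = contradiction (j , sym eq) ¬hit
  g-inj {suc i} {zero} eq = contradiction (i , eq) ¬hit
  g-inj {suc i} {suc j} eq = cong suc (f-inj eq)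

argmax : ∀ {n} (f : Fin (suc n) → ℕ) → ∃[ i ] (∀ j → f j ≤ f i)
argmax {zero} f = zero , λ { zero → ≤-refl }
argmax {suc n} f with argmax (f ∘ suc)
... | i , max with ≤-total (f zero) (f (suc i))
... | inj₁ le = suc i , λ { zero → le ; (suc j) → max j }
... | inj₂ ge = zero , λ { zero → ≤-refl ; (suc j) → ≤-trans (max j) ge }

-- Greedy cancellation: an element of maximal size on either side has a partner
-- of equal value on the other side, and removing both keeps the sums equal.
module Matching {I I′ : Set} (value : I → ℕ) (value′ : I′ → ℕ) (sz : I → ℕ) (sz′ : I′ → ℕ)
  (Rel : I → I′ → Set) (N : ℕ)
  (rel⇒value : ∀ {i i′} → Rel i i′ → value i ≡ value′ i′)
  (partnerʳ : ∀ {m m′} (f : Fin m → I) (f′ : Fin m′ → I′) → m ≤ N → m′ ≤ N →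
              sum (value ∘ f) ≡ sum (value′ ∘ f′) → ∀ x → (∀ y → sz′ (f′ y) ≤ sz (f x)) → ∃[ y ] Rel (f x) (f′ y))
  (partnerˡ : ∀ {m m′} (f : Fin m → I) (f′ : Fin m′ → I′) → m ≤ N → m′ ≤ N →
              sum (value ∘ f) ≡ sum (value′ ∘ f′) → ∀ y → (∀ x → sz (f x) ≤ sz′ (f′ y)) → ∃[ x ] Rel (f x) (f′ y))
  where

  pair : ∀ {m m′} (f : Fin (suc m) → I) (f′ : Fin (suc m′) → I′) → suc m ≤ N → suc m′ ≤ N →
         sum (value ∘ f) ≡ sum (value′ ∘ f′) → ∃[ x ] ∃[ y ] Rel (f x) (f′ y)
  pair f f′ m≤N m′≤N eq with argmax (sz ∘ f) | argmax (sz′ ∘ f′)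
  ... | x , max | y , max′ with ≤-total (sz (f x)) (sz′ (f′ y))
  ... | inj₁ le = let x′ , r = partnerˡ f f′ m≤N m′≤N eq y (λ z → ≤-trans (max z) le) in x′ , y , r
  ... | inj₂ ge = let y′ , r = partnerʳ f f′ m≤N m′≤N eq x (λ z → ≤-trans (max′ z) ge) in x , y′ , r

  matching : ∀ m m′ (f : Fin m → I) (f′ : Fin m′ → I′) → m ≤ N → m′ ≤ N →
             sum (value ∘ f) ≡ sum (value′ ∘ f′) →
             Σ[ π ∈ Fin m ↔ Fin m′ ] (∀ x → Rel (f x) (f′ (Inverse.to π x)))
  matching zero zero f f′ _ _ _ = ↔-id _ , λ ()
  matching zero (suc m′) f f′ m≤N m′≤N eq with argmax (sz′ ∘ f′)
  ... | y , _ with partnerˡ f f′ m≤N m′≤N eq y (λ ())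
  ... | () , _
  matching (suc m) zero f f′ m≤N m′≤N eq with argmax (sz ∘ f)
  ... | x , _ with partnerʳ f f′ m≤N m′≤N eq x (λ ())
  ... | () , _
  matching (suc m) (suc m′) f f′ m≤N m′≤N eq with pair f f′ m≤N m′≤N eq
  ... | x , y , r with matching m m′ (f ∘ punchIn x) (f′ ∘ punchIn y) (<⇒≤ m≤N) (<⇒≤ m′≤N) eq′
    where
    eq′ : sum (value ∘ f ∘ punchIn x) ≡ sum (value′ ∘ f′ ∘ punchIn y)
    eq′ = +-cancelˡ-≡ (value (f x)) _ _ (begin
      value (f x) + sum (value ∘ f ∘ punchIn x)       ≡⟨ sum-remove {i = x} (value ∘ f) ⟨
      sum (value ∘ f)                                 ≡⟨ eq ⟩
      sum (value′ ∘ f′)                               ≡⟨ sum-remove {i = y} (value′ ∘ f′) ⟩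
      value′ (f′ y) + sum (value′ ∘ f′ ∘ punchIn y)   ≡⟨ cong (_+ sum (value′ ∘ f′ ∘ punchIn y)) (rel⇒value r) ⟨
      value (f x) + sum (value′ ∘ f′ ∘ punchIn y)     ∎)
      where open ≡-Reasoning
  ... | π , rel = insert x y π , related
    where
    related : ∀ z → Rel (f z) (f′ (Inverse.to (insert x y π) z))
    related z with x ≟F z
    ... | yes refl = r
    ... | no x≢z = subst (λ w → Rel (f w) (f′ (punchIn y (Inverse.to π (punchOut x≢z)))))
                             (punchIn-punchOut x≢z) (rel (punchOut x≢z))

Distinct : ∀ {X : Set} {n} → Vec X n → Set
Distinct g = ∀ {i j} → lookup g i ≡ lookup g j → i ≡ j

fresh-value : ∀ {S n} (g : Vec (Fin S) n) → n < S → ∃[ j ] (∀ i → lookup g i ≢ j)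
fresh-value {S} {n} g n<S with any? (λ j → all? (λ i → ¬? (lookup g i ≟F j)))
... | yes p = p
... | no ¬p = contradiction (injective⇒≤ {f = proj₁ ∘ used} λ {a} {b} eq →
                trans (sym (proj₂ (used a))) (trans (cong (lookup g) eq) (proj₂ (used b)))) (<⇒≱ n<S)
  where
  used : ∀ j → ∃[ i ] lookup g i ≡ j
  used j with any? (λ i → lookup g i ≟F j)
  ... | yes u = u
  ... | no ¬u = contradiction (j , λ i eq → ¬u (i , eq)) ¬p

module _ {s k S : ℕ} {A B : Str s k} (ι : Emb A B) (h : Vec (Fin S) (size A)) (h-distinct : Distinct h) where

  grow-colouring : ∀ {n} {ρ : Vec (Fin (size B)) n} → Grow ι ρ → n ≤ S →
    Σ[ g ∈ Vec (Fin S) n ] (Distinct g × (∀ a → ∃[ i ] (lookup ρ i ≡ lookup (emb ι) a × lookup g i ≡ lookup h a)))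
  grow-colouring base _ = h , h-distinct , λ a → a , refl , refl
  grow-colouring (step G e fresh att) n<S with grow-colouring G (<⇒≤ n<S)
  ... | g , g-distinct , extends with fresh-value g n<S
  ... | j , new = j ∷ g , distinct , λ a → let i , p , q = extends a in suc i , p , q
    where
    distinct : Distinct (j ∷ g)
    distinct {zero} {zero} eq = refl
    distinct {zero} {suc i′} eq = contradiction (sym eq) (new i′)
    distinct {suc i} {zero} eq = contradiction eq (new i)
    distinct {suc i} {suc i′} eq = cong suc (g-distinct eq)

  extend-colouring : size B ≤ S → Σ[ g ∈ Vec (Fin S) (size B) ] (Distinct g × mapV (lookup g) (emb ι) ≡ h)
  extend-colouring B≤S with grow-colouring (orderGrow ι) (≤-trans (order-length≤ ι) B≤S)
  ... | g , g-distinct , extends = unorder ι g , distinct , lookup-ext agrees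
    where
    distinct : Distinct (unorder ι g)
    distinct {i} {j} eq = trans (sym (order-position ι i)) (trans (cong (lookup (order ι)) (g-distinct
      (trans (sym (lookup∘tabulate (lookup g ∘ position ι) i)) (trans eq (lookup∘tabulate (lookup g ∘ position ι) j)))))
      (order-position ι j))
    agrees : ∀ a → lookup (mapV (lookup (unorder ι g)) (emb ι)) a ≡ lookup h a
    agrees a with extends a
    ... | i , p , q = trans (lookup-map a (lookup (unorder ι g)) (emb ι))
      (trans (cong (lookup (unorder ι g)) (sym p)) (trans (lookup-unorder ι g i) q))

-- Recovering a pattern from its code

module Recovery (s k S : ℕ) .{{_ : NonZero S}} where

  open Codes s k S

  -- This is what allows cancellation: once two children are matched with isomorphic subpatterns,
  -- they contribute equally to both sums.
  code-invariant : ∀ {A A′ : Str s k} {Φ : PTree A} {Φ′ : PTree A′} {τ : Iso A A′} → PIso Φ Φ′ τ →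
    size A ≤ S → bound Φ ≤ S → bound Φ′ ≤ S →
    ∀ {h h′} → (∀ a → lookup h′ (Iso.to τ a) ≡ lookup h a) → code Φ h ≡ code Φ′ h′
  code-invariant (node {A} {A′} {c} {c′} {B} {B′} {ι} {ι′} {sub} {sub′} {τ} π σ ext rec) A≤S b b′ {h} {h′} h≡ = begin
    sum (λ i → contribution (ι i) (code (sub i)) h)
      ≡⟨ sum-cong-≗ (λ i → contribution-invariant (ι i) (ι′ (to π i)) τ (σ i) (ext i) A≤S
           (≤-trans (m≤m+n _ _) (bi i)) (≤-trans (m≤m+n _ _) (bi′ (to π i))) (code (sub i)) (code (sub′ (to π i)))
           (λ g g′ g≡ → code-invariant (rec i) (≤-trans (m≤m+n _ _) (bi i)) (≤-trans (m≤n+m _ (size (B i))) (bi i))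
             (≤-trans (m≤n+m _ (size (B′ (to π i)))) (bi′ (to π i))) g≡)
           h h′ h≡) ⟩
    sum (λ i → contribution (ι′ (to π i)) (code (sub′ (to π i))) h′)
      ≡⟨ sum-permute (λ j → contribution (ι′ j) (code (sub′ j)) h′) π ⟨
    sum (λ j → contribution (ι′ j) (code (sub′ j)) h′) ∎
    where
    open ≡-Reasoning
    open Inverse using (to)
    bi : ∀ i → size (B i) + bound (sub i) ≤ S
    bi i = ≤-trans (childSize≤bound c B ι sub i) b
    bi′ : ∀ i → size (B′ i) + bound (sub′ i) ≤ S
    bi′ i = ≤-trans (childSize≤bound c′ B′ ι′ sub′ i) b′

  termExponents : ∀ {m} {A : Str s k} (B : Fin m → Str s k) (ι : ∀ i → Emb A (B i))
                  (F : ∀ i → Vec (Fin S) (size (B i)) → ℕ) → Vec (Fin S) (size A) → List ℕ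
  termExponents {m} B ι F h = concatMap (λ i → map (exponent (F i)) (terms (ι i) S h)) (allFin m)

  powerSum-termExponents : ∀ {m} {A : Str s k} B (ι : ∀ i → Emb A (B i)) F h →
    powerSum R (termExponents {m} B ι F h) ≡ sum (λ i → contribution (ι i) (F i) h)
  powerSum-termExponents {m} B ι F h =
    trans (sum-concatMap (R ^_) (λ i → map (exponent (F i)) (terms (ι i) S h)) (allFin m))
          (sum-tabulate (λ i → contribution (ι i) (F i) h) id)

  length-termExponents : ∀ {m} {A : Str s k} B (ι : ∀ i → Emb A (B i)) F h → m ≤ S → (∀ i → size (B i) ≤ S) →
                         length (termExponents {m} B ι F h) < R
  length-termExponents {m} B ι F h m≤S B≤S = subst (length (termExponents B ι F h) <_) (sym R≡) (s≤s (begin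
    length (termExponents B ι F h)
      ≤⟨ length-concatMap≤ (λ i → map (exponent (F i)) (terms (ι i) S h)) ((S * suc S) ^ S)
           (λ i → ≤-trans (≤-reflexive (length-map (exponent (F i)) (terms (ι i) S h))) (length-terms (ι i) S (B≤S i) h))
           (allFin m) ⟩
    length (allFin m) * (S * suc S) ^ S   ≡⟨ cong (_* (S * suc S) ^ S) (length-tabulate {n = m} id) ⟩
    m * (S * suc S) ^ S                   ≤⟨ *-monoˡ-≤ ((S * suc S) ^ S) m≤S ⟩
    S * (S * suc S) ^ S                   ∎))
    where open ≤-Reasoning

  monomialCode-⊆ : ∀ μ μ′ → length μ ≤ S → length μ′ ≤ S → monomialCode μ ≡ monomialCode μ′ →
                   ∀ {p} → p ∈ μ → p ∈ μ′
  monomialCode-⊆ μ μ′ len len′ eq p∈ with ∈-map⁻ factorIndex (∈-resp-↭ perm (∈-map⁺ factorIndex p∈))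
    where
    perm : map factorIndex μ ↭ map factorIndex μ′
    perm = powerSum-injective (map factorIndex μ) (map factorIndex μ′)
      (s≤s (≤-trans (≤-reflexive (length-map factorIndex μ)) len))
      (s≤s (≤-trans (≤-reflexive (length-map factorIndex μ′)) len′)) eq
  ... | p′ , p′∈ , eq′ = subst (_∈ μ′) (sym (factorIndex-injective eq′)) p′∈

  -- What one common exponent reveals about two children: everything that the recursive call needs,
  -- namely an isomorphism of labels over `τ` and one injective colouring at which the codes of the
  -- subpatterns agree.
  record Link {A A′ B B′ : Str s k} (τ : Iso A A′) (ι : Emb A B) (ι′ : Emb A′ B′)
              (F : Vec (Fin S) (size B) → ℕ) (F′ : Vec (Fin S) (size B′) → ℕ) : Set where
    field
      σ        : Iso B B′
      extends  : ∀ a → Iso.to σ (lookup (emb ι) a) ≡ lookup (emb ι′) (Iso.to τ a)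
      g        : Vec (Fin S) (size B)
      g′       : Vec (Fin S) (size B′)
      distinct : Distinct g
      agree    : ∀ e → lookup g′ (Iso.to σ e) ≡ lookup g e
      value≡   : F g ≡ F′ g′

  link-sym : ∀ {A A′ B B′ : Str s k} {τ : Iso A A′} {ι : Emb A B} {ι′ : Emb A′ B′} {F F′} →
             Link (iso-sym τ) ι′ ι F′ F → Link τ ι ι′ F F′
  link-sym {τ = τ} {ι} {ι′} l = record
    { σ = iso-sym L.σ
    ; extends = λ a → trans (cong (iso-from L.σ)
                              (trans (cong (lookup (emb ι)) (sym (from-to τ a))) (sym (L.extends (Iso.to τ a)))))
                            (from-to L.σ _)
    ; g = L.g′ ; g′ = L.g
    ; distinct = λ {i} {j} eq → trans (sym (to-from L.σ i)) (trans (cong (Iso.to L.σ) (L.distinct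
        (trans (agree⁻ i) (trans eq (sym (agree⁻ j)))))) (to-from L.σ j))
    ; agree = agree⁻
    ; value≡ = sym L.value≡ }
    where
    module L = Link l
    agree⁻ : ∀ e → lookup L.g (iso-from L.σ e) ≡ lookup L.g′ e
    agree⁻ e = trans (sym (L.agree _)) (cong (lookup L.g′) (to-from L.σ e))

  module _ {A A′ B B′ : Str s k} (τ : Iso A A′) (ι : Emb A B) (ι′ : Emb A′ B′)
           (g : Vec (Fin S) (size B)) (g′ : Vec (Fin S) (size B′)) (g-distinct : Distinct g)
           (|B′|≤|B| : size B′ ≤ size B) where

    -- The parents are compared by colour only: `g′` comes from an unknown term and is not yet known
    -- to be injective.
    record Twin (e : Fin (size B)) : Set where
      field
        twin    : Fin (size B′)
        colour≡ : lookup g′ twin ≡ lookup g e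
        parent≡ : lookup g′ (parent B′ twin) ≡ lookup g (parent B e)
        label≡  : label B′ twin ≡ label B e

    factor⇒twin : ∀ {e e′ p} → IsFactor ι S g e p → IsFactor ι′ S g′ e′ p → Twin e
    factor⇒twin {e} {e′} f f′ = go f f′ refl
      where
      go : ∀ {p p′} → IsFactor ι S g e p → IsFactor ι′ S g′ e′ p′ → p ≡ p′ → Twin e
      go (rootFactor r) (rootFactor r′) eq = record { twin = e′ ; colour≡ = g≡
        ; parent≡ = trans (cong (lookup g′) r′) (trans g≡ (cong (lookup g) (sym r)))
        ; label≡ = sym (cong (proj₁ ∘ proj₂) eq) }
        where g≡ = sym (cong (proj₂ ∘ proj₂) eq)
      go (childFactor _) (childFactor _) eq = record { twin = e′ ; colour≡ = sym (cong (proj₂ ∘ proj₂) eq)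
        ; parent≡ = sym (Fin-suc-injective (cong proj₁ eq)) ; label≡ = sym (cong (proj₁ ∘ proj₂) eq) }
      go (rootFactor _) (childFactor _) eq = contradiction (cong proj₁ eq) λ ()
      go (childFactor _) (rootFactor _) eq = contradiction (cong proj₁ eq) λ ()

    base⇒twin : (∀ a → lookup g′ (lookup (emb ι′) (Iso.to τ a)) ≡ lookup g (lookup (emb ι) a)) →
                ∀ a → Twin (lookup (emb ι) a)
    base⇒twin g≡ a = record
      { twin = lookup (emb ι′) (Iso.to τ a)
      ; colour≡ = g≡ a
      ; parent≡ = trans (cong (lookup g′) (trans (proj₂ (proj₂ (ι-isEmb ι′)) _)
                    (cong (lookup (emb ι′)) (Iso.to-parent τ a))))
                  (trans (g≡ (parent A a)) (cong (lookup g) (sym (proj₂ (proj₂ (ι-isEmb ι)) a))))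
      ; label≡ = trans (proj₁ (proj₂ (ι-isEmb ι′)) _) (trans (Iso.to-label τ a) (sym (proj₁ (proj₂ (ι-isEmb ι)) a))) }

    -- Injectivity of `g` makes the twin map injective, and the bound on sizes makes it bijective.
    -- Hence `g′` is injective too, and only now do equal colours give equal edges, that is,
    -- compatibility with parents and with `τ`.
    twins⇒link : (∀ e → Twin e) →
                 (∀ a → lookup g′ (lookup (emb ι′) (Iso.to τ a)) ≡ lookup g (lookup (emb ι) a)) →
                 ∀ {F F′} → F g ≡ F′ g′ → Link τ ι ι′ F F′
    twins⇒link twins g≡ F≡ = record
      { σ = record { bij = bijective⇒↔ f f-injective surj ; to-label = Twin.label≡ ∘ twins
                   ; to-parent = λ e → g′-distinct (trans (Twin.parent≡ (twins e))
                       (sym (Twin.colour≡ (twins (parent B e))))) }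
      ; extends = λ a → g′-distinct (trans (Twin.colour≡ (twins _)) (sym (g≡ a)))
      ; g = g ; g′ = g′ ; distinct = g-distinct ; agree = Twin.colour≡ ∘ twins ; value≡ = F≡ }
      where
      f : Fin (size B) → Fin (size B′)
      f = Twin.twin ∘ twins
      f-injective : ∀ {i j} → f i ≡ f j → i ≡ j
      f-injective {i} {j} eq = g-distinct
        (trans (sym (Twin.colour≡ (twins i))) (trans (cong (lookup g′) eq) (Twin.colour≡ (twins j))))
      surj : ∀ e′ → ∃[ e ] f e ≡ e′
      surj = injective⇒surjective f f-injective |B′|≤|B|
      g′-distinct : Distinct g′
      g′-distinct {i} {j} eq with surj i | surj j
      ... | x , refl | y , refl =
        cong f (g-distinct (trans (sym (Twin.colour≡ (twins x))) (trans eq (Twin.colour≡ (twins y)))))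

  -- Maximality of B x makes the injection B x → B′ y given by equal colours a bijection.
  partner : ∀ {A A′ : Str s k} (τ : Iso A A′) h h′ → Distinct h → (∀ a → lookup h′ (Iso.to τ a) ≡ lookup h a) →
    ∀ {m m′} (B : Fin m → Str s k) (ι : ∀ i → Emb A (B i)) F (B′ : Fin m′ → Str s k) (ι′ : ∀ i → Emb A′ (B′ i)) F′ →
    m ≤ S → m′ ≤ S → (∀ i → size (B i) ≤ S) → (∀ i → size (B′ i) ≤ S) →
    sum (λ i → contribution (ι i) (F i) h) ≡ sum (λ i → contribution (ι′ i) (F′ i) h′) →
    ∀ x → (∀ y → size (B′ y) ≤ size (B x)) → ∃[ y ] Link τ (ι x) (ι′ y) (F x) (F′ y)
  partner {A} {A′} τ h h′ h-distinct h≡ {m} {m′} B ι F B′ ι′ F′ m≤S m′≤S B≤S B′≤S eq x max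
    with extend-colouring (ι x) h h-distinct (B≤S x)
  ... | g , g-distinct , g-extends with term-leading (ι x) S g
  ... | μ , μ∈ , len , factors
    -- Both sums have fewer than `R` powers of `R`, so their exponents agree as multisets and that
    -- of the leading term of `x` must occur on the other side.
    with find (∈-concatMap⁻ (λ i → map (exponent (F′ i)) (terms (ι′ i) S h′)) {xs = allFin m′} (∈-resp-↭ perm μ∈exps))
    where
    perm : termExponents B ι F h ↭ termExponents B′ ι′ F′ h′
    perm = powerSum-injective _ _ (length-termExponents B ι F h m≤S B≤S) (length-termExponents B′ ι′ F′ h′ m′≤S B′≤S)
      (trans (powerSum-termExponents B ι F h) (trans eq (sym (powerSum-termExponents B′ ι′ F′ h′))))
    μ∈exps : exponent (F x) (μ , g) ∈ termExponents B ι F h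
    μ∈exps = ∈-concatMap (λ i → map (exponent (F i)) (terms (ι i) S h)) (∈-allFin x)
      (∈-map⁺ (exponent (F x)) (subst (λ z → (μ , g) ∈ terms (ι x) S z) g-extends μ∈))
  ... | y , _ , y∈ with ∈-map⁻ (exponent (F′ y)) y∈
  ... | (μ′ , g′) , μ′∈ , exp≡ with term-sound (ι′ y) S h′ μ′∈
  ... | g′-extends , len′ , factors′ =
    y , twins⇒link τ (ι x) (ι′ y) g g′ g-distinct (max y) twins g≡ (proj₂ codes≡)
    where
    |μ|≤S : length μ ≤ S
    |μ|≤S = ≤-trans (m≤n+m (length μ) (size A)) (≤-trans (≤-reflexive len) (B≤S x))
    |μ′|≤S : length μ′ ≤ S
    |μ′|≤S = ≤-trans (m≤n+m (length μ′) (size A′)) (≤-trans len′ (B′≤S y))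
    codes≡ : monomialCode μ ≡ monomialCode μ′ × F x g ≡ F′ y g′
    codes≡ = divMod-unique (F x g) (F′ y g′) (monomialCode<W μ |μ|≤S) (monomialCode<W μ′ |μ′|≤S) exp≡
    g≡ : ∀ a → lookup g′ (lookup (emb (ι′ y)) (Iso.to τ a)) ≡ lookup g (lookup (emb (ι x)) a)
    g≡ a = begin
      lookup g′ (lookup (emb (ι′ y)) (Iso.to τ a))         ≡⟨ lookup-map _ (lookup g′) (emb (ι′ y)) ⟨
      lookup (mapV (lookup g′) (emb (ι′ y))) (Iso.to τ a)  ≡⟨ cong (λ v → lookup v (Iso.to τ a)) g′-extends ⟩
      lookup h′ (Iso.to τ a)                               ≡⟨ h≡ a ⟩
      lookup h a                                           ≡⟨ cong (λ v → lookup v a) g-extends ⟨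
      lookup (mapV (lookup g) (emb (ι x))) a               ≡⟨ lookup-map a (lookup g) (emb (ι x)) ⟩
      lookup g (lookup (emb (ι x)) a)                      ∎
      where open ≡-Reasoning
    twins : ∀ e → Twin τ (ι x) (ι′ y) g g′ g-distinct (max y) e
    twins e with factors e
    -- Edges of the old label contribute no factor, so their twins come from `τ`; the twin of a new
    -- edge is found through its factor.
    ... | inj₁ (a , refl) = base⇒twin τ (ι x) (ι′ y) g g′ g-distinct (max y) g≡ a
    ... | inj₂ (p , p∈ , f) with factors′ (monomialCode-⊆ μ μ′ |μ|≤S |μ′|≤S (proj₁ codes≡) p∈)
    ... | e′ , f′ = factor⇒twin τ (ι x) (ι′ y) g g′ g-distinct (max y) f f′

  -- Equality of codes is assumed at a single injective colouring, since a `Link` provides no more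
  -- for the children.
  recover : ∀ {A A′ : Str s k} (Φ : PTree A) (Φ′ : PTree A′) →
    bound Φ ≤ S → bound Φ′ ≤ S → size A ≤ S → size A′ ≤ S → ∀ (τ : Iso A A′) h h′ →
    Distinct h → (∀ a → lookup h′ (Iso.to τ a) ≡ lookup h a) →
    code Φ h ≡ code Φ′ h′ → PIso Φ Φ′ τ
  recover (node c B ι sub) (node c′ B′ ι′ sub′) b b′ A≤S A′≤S τ h h′ h-distinct h≡ eq =
    node π (λ i → proj₁ (rel i)) (λ i → proj₁ (proj₂ (rel i))) (λ i → proj₂ (proj₂ (rel i)))
    where
    B≤S : ∀ i → size (B i) ≤ S
    B≤S i = ≤-trans (m≤m+n _ _) (≤-trans (childSize≤bound c B ι sub i) b)
    B′≤S : ∀ i → size (B′ i) ≤ S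
    B′≤S i = ≤-trans (m≤m+n _ _) (≤-trans (childSize≤bound c′ B′ ι′ sub′ i) b′)
    sub≤S : ∀ i → bound (sub i) ≤ S
    sub≤S i = ≤-trans (m≤n+m _ (size (B i))) (≤-trans (childSize≤bound c B ι sub i) b)
    sub′≤S : ∀ i → bound (sub′ i) ≤ S
    sub′≤S i = ≤-trans (m≤n+m _ (size (B′ i))) (≤-trans (childSize≤bound c′ B′ ι′ sub′ i) b′)
    Rel : Fin c → Fin c′ → Set
    Rel i j = Σ[ σ ∈ Iso (B i) (B′ j) ]
      ((∀ a → Iso.to σ (lookup (emb (ι i)) a) ≡ lookup (emb (ι′ j)) (Iso.to τ a)) × PIso (sub i) (sub′ j) σ)
    link⇒rel : ∀ i j → Link τ (ι i) (ι′ j) (code (sub i)) (code (sub′ j)) → Rel i j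
    link⇒rel i j l = σ , extends ,
      recover (sub i) (sub′ j) (sub≤S i) (sub′≤S j) (B≤S i) (B′≤S j) σ g g′ distinct agree value≡
      where open Link l
    rel⇒value : ∀ {i j} → Rel i j → contribution (ι i) (code (sub i)) h ≡ contribution (ι′ j) (code (sub′ j)) h′
    rel⇒value {i} {j} (σ , ext , iso) = contribution-invariant (ι i) (ι′ j) τ σ ext A≤S (B≤S i) (B′≤S j)
      (code (sub i)) (code (sub′ j)) (λ g g′ g≡ → code-invariant iso (B≤S i) (sub≤S i) (sub′≤S j) g≡) h h′ h≡
    h′-distinct : Distinct h′
    h′-distinct {i} {j} e = trans (sym (to-from τ i)) (trans (cong (Iso.to τ) (h-distinct
      (trans (sym (h≡⁻ i)) (trans e (h≡⁻ j))))) (to-from τ j))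
      where
      h≡⁻ : ∀ a → lookup h′ a ≡ lookup h (iso-from τ a)
      h≡⁻ a = trans (cong (lookup h′) (sym (to-from τ a))) (h≡ _)
    h≡⁻ : ∀ a → lookup h (Iso.to (iso-sym τ) a) ≡ lookup h′ a
    h≡⁻ a = trans (sym (h≡ _)) (cong (lookup h′) (to-from τ a))
    worth : Fin c → ℕ
    worth i = contribution (ι i) (code (sub i)) h
    worth′ : Fin c′ → ℕ
    worth′ j = contribution (ι′ j) (code (sub′ j)) h′
    partnerʳ : ∀ {m m′} (f : Fin m → Fin c) (f′ : Fin m′ → Fin c′) → m ≤ S → m′ ≤ S →
      sum (worth ∘ f) ≡ sum (worth′ ∘ f′) →
      ∀ x → (∀ y → size (B′ (f′ y)) ≤ size (B (f x))) → ∃[ y ] Rel (f x) (f′ y)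
    partnerʳ f f′ m≤S m′≤S e x max =
      let y , l = partner τ h h′ h-distinct h≡ (B ∘ f) (λ i → ι (f i)) (λ i → code (sub (f i)))
                      (B′ ∘ f′) (λ i → ι′ (f′ i)) (λ i → code (sub′ (f′ i)))
                      m≤S m′≤S (λ i → B≤S (f i)) (λ i → B′≤S (f′ i)) e x max
      in y , link⇒rel (f x) (f′ y) l
    partnerˡ : ∀ {m m′} (f : Fin m → Fin c) (f′ : Fin m′ → Fin c′) → m ≤ S → m′ ≤ S →
      sum (worth ∘ f) ≡ sum (worth′ ∘ f′) →
      ∀ y → (∀ x → size (B (f x)) ≤ size (B′ (f′ y))) → ∃[ x ] Rel (f x) (f′ y)
    -- The argument is applied with the patterns exchanged, along the inverse of `τ`, and the
    -- resulting link is turned around.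
    partnerˡ f f′ m≤S m′≤S e y max =
      let x , l = partner (iso-sym τ) h′ h h′-distinct h≡⁻ (B′ ∘ f′) (λ i → ι′ (f′ i)) (λ i → code (sub′ (f′ i)))
                      (B ∘ f) (λ i → ι (f i)) (λ i → code (sub (f i)))
                      m′≤S m≤S (λ i → B′≤S (f′ i)) (λ i → B≤S (f i)) (sym e) y max
      in x , link⇒rel (f x) (f′ y) (link-sym l)
    open Matching worth worth′ (size ∘ B) (size ∘ B′) Rel S rel⇒value partnerʳ partnerˡ
    result : Σ[ π ∈ Fin c ↔ Fin c′ ] (∀ x → Rel x (Inverse.to π x))
    result = matching c c′ id id (≤-trans (children≤bound c B ι sub) b) (≤-trans (children≤bound c′ B′ ι′ sub′) b′) eq
    π = proj₁ result
    rel = proj₂ result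

theorem5p6 : (s k : ℕ) (Φ₁ Φ₂ : Pattern s k) →
    ¬ (Φ₁ ≅ᵖ Φ₂) → ∃[ t ] ¬ (⟦ Φ₁ ⟧ t ≅ᵘ ⟦ Φ₂ ⟧ t)
theorem5p6 s k Φ₁ Φ₂ Φ₁≇Φ₂ = t , λ iso → Φ₁≇Φ₂ (τ , recover Φ₁ Φ₂ b₁ b₂ z≤n z≤n τ [] [] (λ { {()} }) (λ ())
    (hasCode-unique iso (eval-hasCode Φ₁ b₁ (emptyEmb t)) (eval-hasCode Φ₂ b₂ (emptyEmb t))))
  where
  S : ℕ
  -- The successor keeps `S` positive even if both patterns consist of the root alone.
  S = suc (bound Φ₁ + bound Φ₂)
  open Codes s k S
  open Recovery s k S
  open Counting s S k weight using (t)
  b₁ : bound Φ₁ ≤ S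
  b₁ = m≤n⇒m≤1+n (m≤m+n _ _)
  b₂ : bound Φ₂ ≤ S
  b₂ = m≤n⇒m≤1+n (m≤n+m _ _)
  τ : Iso {s} {k} emptyStr emptyStr
  τ = record { bij = ↔-id _ ; to-label = λ () ; to-parent = λ () }
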